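{- Let $n\ge 2$, $v\in\tilde{S}_n$, $r\in\mathbb{Z}$, and let $\alpha=(\alpha_1,\dots,\alpha_m)$ be a composition of $\ell(v)+1$. The generalized affine Little algorithm (described in the context) is well defined and gives a bijection from the set of $\alpha$-decompositions of elements of $\Psi^+_r(v)$ to the set of $\alpha$-decompositions of elements of $\Psi^-_r(v)$.
   Context: $\tilde{S}_n$ is the affine symmetric group (bijections $w:\mathbb{Z}\to\mathbb{Z}$ with $w(i+n)=w(i)+n$, $\sum_{i=1}^n w(i)=\sum_{i=1}^n i$), a Coxeter group with simple reflections $s_i$, $i\in\mathbb{Z}/n\mathbb{Z}$. For $r\not\equiv s\pmod n$, $t_{r,s}$ swaps $r$ and $s$ and fixes every integer not congruent to $r$ or $s$ mod $n$. $\ell$ is length; $v\lessdot w$ means $w=vt_{p,q}$ for some $p,q$ and $\ell(w)=\ell(v)+1$. $\Psi^+_r(v)=\{w: v\lessdot w,\ w=vt_{r,s},\ s>r\}$ and $\Psi^-_r(v)=\{w: v\lessdot w,\ w=vt_{s,r},\ s<r\}$. A proper subset $I\subsetneq\mathbb{Z}/n\mathbb{Z}$ of the form $\{i,i+1,\dots,i+j\}$ is a cyclic interval with word $(i+j)\cdots(i+1)i$. For a proper subset $A\subsetneq\mathbb{Z}/n\mathbb{Z}$, $w(A)\in\tilde{S}_n$ is the element with reduced word any shuffle of the words of the maximal cyclic subintervals of $A$; the cyclically decreasing elements of $\tilde{S}_n$ are exactly the $w(A)$, and $\ell(w(A))=|A|$, $w(A)\le w(B)$ in Bruhat order iff $A\subseteq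 B$. An $\alpha$-decomposition of $w$ with $\ell(w)=\sum\alpha_k$ is a tuple $(w^1,\dots,w^m)$ of cyclically decreasing elements with $\ell(w^k)=\alpha_k$ and $w=w^1\cdots w^m$. For $A$ a proper subset and $i\in A$, define $A'=\mathrm{L}(A,i)$ as follows: let $j\ge0$ be maximal with $\{i,i-1,\dots,i-j\}\subseteq A$ (mod $n$), and let $A'$ be obtained from $A$ by replacing $i$ with $i-j-1$; the induced map sends the cover $w(A)$ of $w(A\setminus\{i\})$ to the cover $w(A')$ of $w(A\setminus\{i\})$, and $i-j-1$ is the element of $A'$ whose removal gives $A\setminus\{i\}$. Algorithm: given an $\alpha$-decomposition $(y^1,\dots,y^m)$, $y^k=w(A_k)$, of $w\in\Psi^+_r(v)$, there is a unique factor index $i$ and element $a\in A_i$ with $v=y^1\cdots w(A_i\setminus\{a\})\cdots y^m$. (1) Replace $A_i$ by $\mathrm{L}(A_i,a)$ (so $y^i$ becomes $w(\mathrm{L}(A_i,a))$, marked at the new element $a^*$ with $A_i\setminus\{a\}=\mathrm{L}(A_i,a)\setminus\{a^*\}$). (2) If the new tuple is an $\alpha$-decomposition of its product (i.e. the product has length $\ell(v)+1$), output it. Otherwise there is a unique factor index $j\ne i$ and element $b\in A_j$ with $v$ equal to the product of the new tuple with $y^j$ replaced by $w(A_j\setminus\{b\})$; set $i:=j$, $a:=b$ and return to (1). -}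

module Defs where

open import Data.Bool.Base using (if_then_else_)
open import Data.Fin.Base using (Fin; toℕ; fromℕ<)
open import Data.Fin.Properties using (toℕ-fromℕ<; toℕ-injective; toℕ<n)
open import Data.Fin.Permutation using (Permutation′; permutation; _⟨$⟩ʳ_)
open import Data.Fin.Subset using (Subset; _∈_; _⊂_; ⊤; ⁅_⁆; _∪_) renaming (_-_ to _∖_)
open import Data.Fin.Subset.Properties using (_∈?_)
open import Data.Integer.Base hiding (suc; pred; NonZero; NonNegative)
open import Data.Integer.DivMod using (n%ℕd<d; a≡a%ℕn+[a/ℕn]*n)
open import Data.Integer.Divisibility.Signed
  using (_∣_; divides; _∣?_; ∣⇒∣ᵤ; ∣m⇒∣-m; ∣m∣n⇒∣m+n)
open import Data.Integer.Properties
  using (+-0-commutativeMonoid; +-identityʳ; +-inverseʳ; +-injective; m-n≡m⊖n; ∣i∣≡0⇒i≡0;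
         i-j≡0⇒i≡j; ∣m⊝n∣≤m⊔n)
open import Data.Integer.Tactic.RingSolver using (solve-∀)
open import Data.List.Base as List using (List; []; _∷_; _∷ʳ_; length; allFin)
open import Data.Nat.Base as ℕ using (ℕ; zero; suc; NonTrivial; NonZero)
import Data.Nat.Divisibility as ℕ
import Data.Nat.Properties as ℕ
open import Data.Nat.DivMod using (_mod_)
open import Data.Product.Base using (∃-syntax; Σ-syntax; _×_; _,_; proj₁; proj₂)
open import Data.Product using (∃!)
open import Data.Vec.Base as Vec using (Vec; lookup; _[_]%=_)
open import Data.Vec.Relation.Binary.Pointwise.Inductive as Pointwise using (Pointwise)
open import Data.Vec.Relation.Unary.All using (All)
open import Function.Base using (_∘_)
open import Function.Bundles using (_↔_; Inverse; mk↔ₛ′; mk⇔)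
open import Function.Construct.Composition using (_↔-∘_)
open import Function.Construct.Identity using (↔-id)
open import Level using (0ℓ)
open import Relation.Binary.Bundles using (Setoid)
open import Relation.Binary.Core using (Rel)
import Relation.Binary.Construct.On as On
open import Relation.Binary.PropositionalEquality
  using (_≡_; _≢_; refl; sym; trans; cong; cong₂; subst; _→-setoid_; module ≡-Reasoning)
open import Relation.Nullary using (¬_; Dec; does; yes; no; contradiction)
open import Relation.Nullary.Decidable using (¬?; map′; _×-dec_; dec-true; dec-false; does-⇔)
open import Relation.Unary using (Pred)
open import Algebra.Properties.CommutativeMonoid.Sum +-0-commutativeMonoid
  using (sum; sum-syntax; ∑-distrib-+; sum-permute; sum-cong-≗)

module AffineSymmetric (n : ℕ) .{{_ : NonTrivial n}} where

  instance
    n≢0 : NonZero n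
    n≢0 = ℕ.nonTrivial⇒nonZero n

  infix 4 _≡ₙ_ _≢ₙ_ _≡ₙ?_

  record _≡ₙ_ (x y : ℤ) : Set where
    constructor congruent
    field
      n∣x-y : + n ∣ x - y

  open _≡ₙ_

  _≢ₙ_ : Rel ℤ 0ℓ
  x ≢ₙ y = ¬ x ≡ₙ y

  _≡ₙ?_ : ∀ x y → Dec (x ≡ₙ y)
  x ≡ₙ? y = map′ congruent n∣x-y (+ n ∣? x - y)

  ≡ₙ-refl : ∀ {x} → x ≡ₙ x
  ≡ₙ-refl {x} = congruent (divides 0ℤ (+-inverseʳ x))

  ≡ₙ-sym : ∀ {x y} → x ≡ₙ y → y ≡ₙ x
  ≡ₙ-sym {x} {y} p = congruent (subst (+ n ∣_) (lem x y) (∣m⇒∣-m (n∣x-y p)))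
    where
    lem : ∀ x y → - (x - y) ≡ y - x
    lem = solve-∀

  ≡ₙ-trans : ∀ {x y z} → x ≡ₙ y → y ≡ₙ z → x ≡ₙ z
  ≡ₙ-trans {x} {y} {z} p q = congruent (subst (+ n ∣_) (lem x y z) (∣m∣n⇒∣m+n (n∣x-y p) (n∣x-y q)))
    where
    lem : ∀ x y z → (x - y) + (y - z) ≡ x - z
    lem = solve-∀

  window : Fin n → ℤ
  window i = + suc (toℕ i)

  residue : ℤ → Fin n
  residue x = fromℕ< (n%ℕd<d (x - 1ℤ) n)

  window-residue : ∀ x → window (residue x) ≡ₙ x
  window-residue x = congruent (divides (- q) (begin
    window (residue x) - x             ≡⟨ cong (λ k → + suc k - x) (toℕ-fromℕ< _) ⟩
    1ℤ + + k - x                       ≡⟨ lem₁ (+ k) x ⟩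
    + k - (x - 1ℤ)                     ≡⟨ cong (λ z → + k - z) (a≡a%ℕn+[a/ℕn]*n (x - 1ℤ) n) ⟩
    + k - (+ k + q * + n)              ≡⟨ lem₂ (+ k) q (+ n) ⟩
    - q * + n                          ∎))
    where
    open ≡-Reasoning
    k = (x - 1ℤ) %ℕ n
    q = (x - 1ℤ) /ℕ n
    lem₁ : ∀ k x → 1ℤ + k - x ≡ k - (x - 1ℤ)
    lem₁ = solve-∀
    lem₂ : ∀ k q n → k - (k + q * n) ≡ - q * n
    lem₂ = solve-∀

  window-injective : ∀ {i j} → window i ≡ₙ window j → i ≡ j
  window-injective {i} {j} p = toℕ-injective (+-injective (i-j≡0⇒i≡j (+ a) (+ b) (∣i∣≡0⇒i≡0 small)))
    where
    a = toℕ i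
    b = toℕ j
    lem : ∀ a b → (1ℤ + a) - (1ℤ + b) ≡ a - b
    lem = solve-∀
    n∣ : n ℕ.∣ ∣ + a - + b ∣
    n∣ = ∣⇒∣ᵤ (subst (+ n ∣_) (lem (+ a) (+ b)) (n∣x-y p))
    bound : ∣ + a - + b ∣ ℕ.< n
    bound = ℕ.≤-<-trans
      (subst (λ z → ∣ z ∣ ℕ.≤ a ℕ.⊔ b) (sym (m-n≡m⊖n a b)) (∣m⊝n∣≤m⊔n a b))
      (ℕ.⊔-lub (toℕ<n i) (toℕ<n j))
    small : ∣ + a - + b ∣ ≡ 0
    small with ∣ + a - + b ∣ | n∣ | bound
    ... | zero  | _ | _ = refl
    ... | suc _ | d | l = contradiction (ℕ.∣⇒≤ d) (ℕ.<⇒≱ l)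

  record S̃ : Set where
    field
      perm     : ℤ ↔ ℤ
      periodic : ∀ i → Inverse.to perm (i + + n) ≡ Inverse.to perm i + + n
      balanced : ∑[ i < n ] Inverse.to perm (window i) ≡ ∑[ i < n ] window i

    apply : ℤ → ℤ
    apply = Inverse.to perm

  open S̃ using (apply)

  S̃-setoid : Setoid 0ℓ 0ℓ
  S̃-setoid = On.setoid (ℤ →-setoid ℤ) apply

  open Setoid S̃-setoid public using (_≈_)

  Periodic : (ℤ → ℤ) → Set
  Periodic f = ∀ i → f (i + + n) ≡ f i + + n

  periodic-multiple : ∀ f → Periodic f → ∀ k x → f (x + k * + n) ≡ f x + k * + n
  periodic-multiple f per = go
    where
    open ≡-Reasoning
    zero-lem : ∀ x n → x + 0ℤ * n ≡ x
    zero-lem = solve-∀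
    suc-lem : ∀ k x n → x + (1ℤ + k) * n ≡ (x + k * n) + n
    suc-lem = solve-∀
    neg-lem : ∀ k x n → (x + - k * n) + k * n ≡ x
    neg-lem = solve-∀
    neg-lem′ : ∀ k y n → y ≡ (y + k * n) + - k * n
    neg-lem′ = solve-∀
    goℕ : ∀ k x → f (x + + k * + n) ≡ f x + + k * + n
    goℕ zero x = trans (cong f (zero-lem x (+ n))) (sym (zero-lem (f x) (+ n)))
    goℕ (suc k) x = begin
      f (x + + suc k * + n)       ≡⟨ cong f (suc-lem (+ k) x (+ n)) ⟩
      f ((x + + k * + n) + + n)   ≡⟨ per _ ⟩
      f (x + + k * + n) + + n     ≡⟨ cong (λ z → z + (+ n)) (goℕ k x) ⟩
      (f x + + k * + n) + + n     ≡⟨ suc-lem (+ k) (f x) (+ n) ⟨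
      f x + + suc k * + n         ∎
    go : ∀ k x → f (x + k * + n) ≡ f x + k * + n
    go (+ k)    x = goℕ k x
    go -[1+ k ] x = begin
      f y                                    ≡⟨ neg-lem′ (+ suc k) (f y) (+ n) ⟩
      (f y + + suc k * + n) + - + suc k * + n ≡⟨ cong (λ z → z + (- + suc k * + n)) (goℕ (suc k) y) ⟨
      f (y + + suc k * + n) + - + suc k * + n ≡⟨ cong (λ z → f z + - + suc k * + n) (neg-lem (+ suc k) x (+ n)) ⟩
      f x + - + suc k * + n                  ∎
      where y = x + - + suc k * + n

  -- A periodic function shifts congruent integers by the same amount.
  shift-≡ₙ : ∀ f → Periodic f → ∀ {x y} → x ≡ₙ y → f x - x ≡ f y - y
  shift-≡ₙ f per {x} {y} (congruent (divides k eq)) = begin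
    f x - x                       ≡⟨ cong (λ z → f z - z) x≡ ⟩
    f (y + k * + n) - (y + k * + n) ≡⟨ cong (λ z → z - (y + k * + n)) (periodic-multiple f per k y) ⟩
    (f y + k * + n) - (y + k * + n) ≡⟨ lem (f y) (k * + n) y ⟩
    f y - y                       ∎
    where
    open ≡-Reasoning
    lem : ∀ a b c → (a + b) - (c + b) ≡ a - c
    lem = solve-∀
    lem′ : ∀ x y → x ≡ y + (x - y)
    lem′ = solve-∀
    x≡ : x ≡ y + k * + n
    x≡ = trans (lem′ x y) (cong (λ z → y + z) eq)

  map-≡ₙ : ∀ f → Periodic f → ∀ {x y} → x ≡ₙ y → f x ≡ₙ f y
  map-≡ₙ f per {x} {y} p = congruent (subst (+ n ∣_) (begin
    x - y               ≡⟨ lem (f x - x) x y ⟩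
    (x + (f x - x)) - (y + (f x - x)) ≡⟨ cong (λ z → (x + (f x - x)) - (y + z)) (shift-≡ₙ f per p) ⟩
    (x + (f x - x)) - (y + (f y - y)) ≡⟨ lem′ (f x) (f y) x y ⟩
    f x - f y           ∎) (n∣x-y p))
    where
    open ≡-Reasoning
    lem : ∀ d x y → x - y ≡ (x + d) - (y + d)
    lem = solve-∀
    lem′ : ∀ a b x y → (x + (a - x)) - (y + (b - y)) ≡ a - b
    lem′ = solve-∀

  from-periodic : (u : ℤ ↔ ℤ) → Periodic (Inverse.to u) → Periodic (Inverse.from u)
  from-periodic u per i = begin
    from (i + + n)              ≡⟨ cong (λ z → from (z + + n)) (Inverse.strictlyInverseˡ u i) ⟨
    from (to (from i) + + n)    ≡⟨ cong from (per (from i)) ⟨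
    from (to (from i + + n))    ≡⟨ Inverse.strictlyInverseʳ u _ ⟩
    from i + + n                ∎
    where
    open ≡-Reasoning
    open Inverse u using (to; from)

  -- A periodic bijection permutes the residue classes, so it can be
  -- used to reindex sums of functions of the residue class.
  reindex : (u : ℤ ↔ ℤ) → Periodic (Inverse.to u) →
            (f : ℤ → ℤ) → (∀ {x y} → x ≡ₙ y → f x ≡ f y) →
            ∑[ i < n ] f (Inverse.to u (window i)) ≡ ∑[ i < n ] f (window i)
  reindex u per f f-cong = begin
    ∑[ i < n ] f (to (window i))              ≡⟨ sum-cong-≗ (λ i → f-cong (≡ₙ-sym (window-residue (to (window i))))) ⟩
    ∑[ i < n ] f (window (π ⟨$⟩ʳ i))          ≡⟨ sum-permute (f ∘ window) π ⟨
    ∑[ i < n ] f (window i)                   ∎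
    where
    open ≡-Reasoning
    open Inverse u using (to; from)
    cancel : ∀ g h → Periodic g → (∀ x → g (h x) ≡ x) →
             ∀ i → residue (g (window (residue (h (window i))))) ≡ i
    cancel g h g-per gh i = window-injective (≡ₙ-trans (window-residue _)
      (subst (g (window (residue (h (window i)))) ≡ₙ_) (gh (window i))
        (map-≡ₙ g g-per (window-residue (h (window i))))))
    π : Permutation′ n
    π = permutation (residue ∘ to ∘ window) (residue ∘ from ∘ window)
          (cancel to from per (Inverse.strictlyInverseˡ u))
          (cancel from to (from-periodic u per) (Inverse.strictlyInverseʳ u))

  ε : S̃
  ε = record { perm = ↔-id ℤ ; periodic = λ _ → refl ; balanced = refl }

  infixl 7 _·_

  -- The product is composition of functions, the right factor acting first.
  _·_ : S̃ → S̃ → S̃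
  w · u = record
    { perm     = S̃.perm w ↔-∘ S̃.perm u
    ; periodic = λ i → trans (cong (apply w) (S̃.periodic u i)) (S̃.periodic w (apply u i))
    ; balanced = begin
        ∑[ i < n ] apply w (apply u (window i))
          ≡⟨ sum-cong-≗ (λ i → split (apply u (window i)) (apply w (apply u (window i)))) ⟩
        ∑[ i < n ] (apply u (window i) + d (apply u (window i)))
          ≡⟨ ∑-distrib-+ (apply u ∘ window) (d ∘ apply u ∘ window) ⟩
        ∑[ i < n ] apply u (window i) + ∑[ i < n ] d (apply u (window i))
          ≡⟨ cong₂ _+_ (S̃.balanced u) (reindex (S̃.perm u) (S̃.periodic u) d (shift-≡ₙ (apply w) (S̃.periodic w))) ⟩
        ∑[ i < n ] window i + ∑[ i < n ] d (window i)
          ≡⟨ ∑-distrib-+ window (d ∘ window) ⟨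
        ∑[ i < n ] (window i + d (window i))
          ≡⟨ sum-cong-≗ (λ i → split (window i) (apply w (window i))) ⟨
        ∑[ i < n ] apply w (window i)
          ≡⟨ S̃.balanced w ⟩
        ∑[ i < n ] window i ∎
    }
    where
    open ≡-Reasoning
    d : ℤ → ℤ
    d x = apply w x - x
    split : ∀ x y → y ≡ x + (y - x)
    split = solve-∀

  ∏ : ∀ {m} → Vec S̃ m → S̃
  ∏ = Vec.foldr′ _·_ ε

  -- Only meaningful for r ≢ₙ s.
  shift : ℤ → ℤ → ℤ → ℤ
  shift r s x = if does (x ≡ₙ? r) then s - r
                else if does (x ≡ₙ? s) then r - s
                else 0ℤ

  swap : ℤ → ℤ → ℤ → ℤ
  swap r s x = x + shift r s x

  shift-cong : ∀ r s {x y} → x ≡ₙ y → shift r s x ≡ shift r s y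
  shift-cong r s {x} {y} p = cong₂
    (λ b c → if b then s - r else if c then r - s else 0ℤ) (same r) (same s)
    where
    same : ∀ z → does (x ≡ₙ? z) ≡ does (y ≡ₙ? z)
    same z = does-⇔ (mk⇔ (≡ₙ-trans (≡ₙ-sym p)) (≡ₙ-trans p)) (x ≡ₙ? z) (y ≡ₙ? z)

  shift-r : ∀ r s {x} → x ≡ₙ r → shift r s x ≡ s - r
  shift-r r s {x} p rewrite dec-true (x ≡ₙ? r) p = refl

  shift-s : ∀ r s {x} → r ≢ₙ s → x ≡ₙ s → shift r s x ≡ r - s
  shift-s r s {x} r≢s p
    rewrite dec-false (x ≡ₙ? r) (λ q → r≢s (≡ₙ-trans (≡ₙ-sym q) p))
          | dec-true (x ≡ₙ? s) p = refl

  shift-other : ∀ r s {x} → x ≢ₙ r → x ≢ₙ s → shift r s x ≡ 0ℤ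
  shift-other r s {x} p q
    rewrite dec-false (x ≡ₙ? r) p | dec-false (x ≡ₙ? s) q = refl

  translate : ∀ {x a b} → x ≡ₙ a → x + (b - a) ≡ₙ b
  translate {x} {a} {b} p = congruent (subst (+ n ∣_) (lem x a b) (n∣x-y p))
    where
    lem : ∀ x a b → x - a ≡ (x + (b - a)) - b
    lem = solve-∀

  shift-swap : ∀ r s → r ≢ₙ s → ∀ x → shift r s (swap r s x) ≡ - shift r s x
  shift-swap r s r≢s x = go (x ≡ₙ? r) (x ≡ₙ? s)
    where
    neg-lem : ∀ a b → a - b ≡ - (b - a)
    neg-lem = solve-∀
    via : ∀ {c c′} → shift r s x ≡ c → shift r s (x + c) ≡ c′ → c′ ≡ - c →
          shift r s (swap r s x) ≡ - shift r s x
    via refl eq eq′ = trans eq eq′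
    go : Dec (x ≡ₙ r) → Dec (x ≡ₙ s) → shift r s (swap r s x) ≡ - shift r s x
    go (yes p) _       = via (shift-r r s p) (shift-s r s r≢s (translate p)) (neg-lem r s)
    go (no _)  (yes q) = via (shift-s r s r≢s q) (shift-r r s (translate q)) (neg-lem s r)
    go (no p)  (no q)  = via eq (trans (cong (shift r s) (+-identityʳ x)) eq) refl
      where eq = shift-other r s p q

  swap-involutive : ∀ r s → r ≢ₙ s → ∀ x → swap r s (swap r s x) ≡ x
  swap-involutive r s r≢s x =
    trans (cong (λ z → swap r s x + z) (shift-swap r s r≢s x)) (lem x (shift r s x))
    where
    lem : ∀ x d → (x + d) + - d ≡ x
    lem = solve-∀

  x+n≡ₙx : ∀ x → x + + n ≡ₙ x
  x+n≡ₙx x = congruent (divides 1ℤ (lem x (+ n)))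
    where
    lem : ∀ x n → (x + n) - x ≡ 1ℤ * n
    lem = solve-∀

  i≡-i⇒i≡0 : ∀ i → i ≡ - i → i ≡ 0ℤ
  i≡-i⇒i≡0 (+ zero) _ = refl

  t : (r s : ℤ) → r ≢ₙ s → S̃
  t r s r≢s = record
    { perm     = τ
    ; periodic = τ-periodic
    ; balanced = begin
        ∑[ i < n ] swap r s (window i)                      ≡⟨ ∑-distrib-+ window (shift r s ∘ window) ⟩
        ∑[ i < n ] window i + ∑[ i < n ] shift r s (window i) ≡⟨ cong (λ z → sum window + z) total ⟩
        ∑[ i < n ] window i + 0ℤ                            ≡⟨ +-identityʳ _ ⟩
        ∑[ i < n ] window i                                 ∎
    }
    where
    open ≡-Reasoning
    τ : ℤ ↔ ℤ
    τ = mk↔ₛ′ (swap r s) (swap r s) (swap-involutive r s r≢s) (swap-involutive r s r≢s)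
    lem : ∀ x d n → (x + n) + d ≡ (x + d) + n
    lem = solve-∀
    τ-periodic : Periodic (swap r s)
    τ-periodic x = trans (cong (λ z → (x + + n) + z) (shift-cong r s (x+n≡ₙx x))) (lem x (shift r s x) (+ n))
    sum-neg : ∀ {k} (f : Fin k → ℤ) → sum (-_ ∘ f) ≡ - sum f
    sum-neg {zero}  f = refl
    sum-neg {suc k} f = trans (cong (λ z → - f Fin.zero + z) (sum-neg (f ∘ Fin.suc))) (lem′ (f Fin.zero) _)
      where
      lem′ : ∀ a b → - a + - b ≡ - (a + b)
      lem′ = solve-∀
    total : ∑[ i < n ] shift r s (window i) ≡ 0ℤ
    total = i≡-i⇒i≡0 _ (begin
      ∑[ i < n ] shift r s (window i)              ≡⟨ reindex τ τ-periodic (shift r s) (shift-cong r s) ⟨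
      ∑[ i < n ] shift r s (swap r s (window i))   ≡⟨ sum-cong-≗ (λ i → shift-swap r s r≢s (window i)) ⟩
      ∑[ i < n ] (- shift r s (window i))          ≡⟨ sum-neg (shift r s ∘ window) ⟩
      - (∑[ i < n ] shift r s (window i))          ∎)

  x≢ₙx+1 : ∀ x → x ≢ₙ x + 1ℤ
  x≢ₙx+1 x p = contradiction (ℕ.∣1⇒≡1 (∣⇒∣ᵤ (subst (+ n ∣_) (lem x) (n∣x-y (≡ₙ-sym p))))) (ℕ.nonTrivial⇒≢1)
    where
    lem : ∀ x → (x + 1ℤ) - x ≡ 1ℤ
    lem = solve-∀

  -- Fin n stands for ℤ/nℤ, with residues taken in 0, …, n-1 (not in the
  -- window 1, …, n).
  simple : Fin n → S̃
  simple i = t (+ toℕ i) (+ toℕ i + 1ℤ) (x≢ₙx+1 (+ toℕ i))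

  next prev : Fin n → Fin n
  next i = (toℕ i ℕ.+ 1) mod n
  prev i = (toℕ i ℕ.+ (n ℕ.∸ 1)) mod n

  ⟦_⟧ : List (Fin n) → S̃
  ⟦_⟧ = List.foldr (λ i → simple i ·_) ε

  -- ℓ(w) = k
  record HasLength (w : S̃) (k : ℕ) : Set where
    field
      attained : ∃[ word ] length word ≡ k × w ≈ ⟦ word ⟧
      minimal  : ∀ word → w ≈ ⟦ word ⟧ → k ℕ.≤ length word

  infix 4 _⋖_

  record _⋖_ (v w : S̃) : Set where
    field
      reflection : ∃[ p ] ∃[ q ] Σ[ p≢q ∈ p ≢ₙ q ] w ≈ v · t p q p≢q
      length+1   : ∃[ k ] HasLength v k × HasLength w (suc k)

  Ψ⁺ Ψ⁻ : ℤ → S̃ → Pred S̃ 0ℓ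
  Ψ⁺ r v w = v ⋖ w × ∃[ s ] Σ[ r≢s ∈ r ≢ₙ s ] (s > r × w ≈ v · t r s r≢s)
  Ψ⁻ r v w = v ⋖ w × ∃[ s ] Σ[ s≢r ∈ s ≢ₙ r ] (s < r × w ≈ v · t s r s≢r)

  -- For a proper subset A, intervalWord A n i is the word (i+j)⋯(i+1)i of
  -- the longest cyclic interval in A starting at i; the natural number
  -- bounds the recursion, and n steps always suffice.
  intervalWord : Subset n → ℕ → Fin n → List (Fin n)
  intervalWord A zero    i = []
  intervalWord A (suc k) i =
    if does (i ∈? A) then intervalWord A k (next i) ∷ʳ i else []

  -- The least elements of the maximal cyclic subintervals of A.
  starts : Subset n → List (Fin n)
  starts A = List.filter (λ i → i ∈? A ×-dec ¬? (prev i ∈? A)) (allFin n)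

  -- Letters of distinct maximal intervals commute, so every shuffle of the
  -- words of these intervals represents the same element; the concatenation
  -- is used here. The value is meaningless for A = ⊤.
  w⟨_⟩ : Subset n → S̃
  w⟨ A ⟩ = ⟦ List.concatMap (intervalWord A n) (starts A) ⟧

  CyclicallyDecreasing : Pred S̃ 0ℓ
  CyclicallyDecreasing y = ∃[ A ] A ⊂ ⊤ × y ≈ w⟨ A ⟩

  record IsDecomposition {m} (α : Vec ℕ m) (w : S̃) (ys : Vec S̃ m) : Set where
    field
      length-w   : HasLength w (Vec.sum α)
      decreasing : All CyclicallyDecreasing ys
      lengths    : Pointwise HasLength ys α
      product    : w ≈ ∏ ys

  -- Equality only compares the tuples, since a tuple determines the element
  -- that it decomposes.
  Decompositions : ∀ {m} → Vec ℕ m → Pred S̃ 0ℓ → Setoid 0ℓ 0ℓ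
  Decompositions {m} α P =
    On.setoid (Pointwise.setoid S̃-setoid m)
      (proj₁ {B = λ ys → ∃[ w ] P w × IsDecomposition α w ys})

  -- The first of i, i-1, i-2, … outside A; for A proper it is found within
  -- the bound k = n on the number of steps.
  firstGap : Subset n → ℕ → Fin n → Fin n
  firstGap A zero    i = i
  firstGap A (suc k) i = if does (i ∈? A) then firstGap A k (prev i) else i

  L : Subset n → Fin n → Subset n
  L A i = (A ∖ i) ∪ ⁅ firstGap A n i ⁆

  module Little {m : ℕ} (v : S̃) (α : Vec ℕ m) where

    Tuple Mark : Set
    Tuple = Vec (Subset n) m
    Mark  = Fin m × Fin n

    elements : Tuple → Vec S̃ m
    elements = Vec.map w⟨_⟩

    Removal : Tuple → Mark → Set
    Removal A (i , a) = a ∈ lookup A i × v ≈ ∏ (elements (A [ i ]%= (_∖ a)))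

    replace : Tuple → Mark → Tuple
    replace A (i , a) = A [ i ]%= λ Aᵢ → L Aᵢ a

    Final : Tuple → Set
    Final A = IsDecomposition α (∏ (elements A)) (elements A)

    -- Run A p B: started at A with mark p, the algorithm is well defined at
    -- every iteration and halts with output B.
    data Run (A : Tuple) (p : Mark) : Tuple → Set where
      stop : Final (replace A p) → Run A p (replace A p)
      loop : ∀ {B} → ¬ Final (replace A p) →
             (q! : ∃! _≡_ λ q → proj₁ q ≢ proj₁ p × Removal (replace A p) q) →
             Run (replace A p) (proj₁ q!) B → Run A p B

    -- The algorithm is well defined on ys and outputs zs, whatever choice
    -- of subsets represents ys.
    Outputs : Vec S̃ m → Vec S̃ m → Set
    Outputs ys zs = ∀ A → All (_⊂ ⊤) A → Pointwise _≈_ ys (elements A) →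
      Σ[ p! ∈ ∃! _≡_ (Removal A) ]
        ∃[ B ] Run A (proj₁ p!) B × Pointwise _≈_ zs (elements B)

{-# OPTIONS --safe #-}

-- A tuple (A₁, …, A_m) is drawn as a wiring diagram: the wire of p ∈ ℤ enters at
-- position p on the right and is moved by w⟨ A_m ⟩, …, w⟨ A₁ ⟩ in turn. In one
-- factor, w⟨ A ⟩ sends x to x - 1 when x - 1 ∈ A and to the first y ≥ x outside A
-- otherwise, so the wires at x < y cross in it exactly when x - 1 ∉ A and
-- x, …, y - 1 ∈ A, and deleting the letter y - 1 multiplies w⟨ A ⟩ on the right by
-- t x y. Hence removing a letter from a factor amounts to removing the crossing of
-- two wires p, q, and multiplies the product by t p q.
--
-- If this leaves v, then p and q meet at most twice, because two further meetings
-- could also be removed from the length-minimal factorization of v. If they meet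
-- once, the product is longer than v: every word of it contains a meeting of p and q,
-- whose removal gives a word of v. If they meet twice, the second meeting is the only
-- other letter whose removal gives v, and there p and q have changed sides.
-- Replacing A by L A (y - 1), where the lower wire r is at x, makes r the upper wire
-- of a new crossing, with the same product after removal; a second meeting has r as
-- its lower wire again. The replacement is injective and can be undone from
-- any tuple in which r is the upper wire, so a step of the algorithm is an injective
-- partial map on a finite set, whose domain and range miss the output and the input
-- tuples. Its orbits therefore run from input tuples to output tuples bijectively.

module Submission where

open import Defs
open import Data.Bool.Base using (if_then_else_)
open import Data.Fin.Base as Fin using (Fin; toℕ; fromℕ<)
import Data.Fin.Properties as Fin
open import Data.Fin.Subset using (Subset; inside; outside; _∈_; _∉_; _⊂_; ⊤; ⊥; _∪_; ⁅_⁆)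
  renaming (_-_ to _∖_; ∣_∣ to card)
open import Data.Fin.Subset.Properties as Subset using (_∈?_)
open import Data.Integer.Base using (ℤ; +_; +≤+; +<+; _+_; _-_; -_; _*_; _≤_; _<_; 0ℤ; 1ℤ)
open import Data.Integer.DivMod using (_%ℕ_; _/ℕ_; n%ℕd<d; a≡a%ℕn+[a/ℕn]*n)
open import Data.Integer.Divisibility.Signed using (_∣_; divides; ∣⇒∣ᵤ)
import Data.Integer.Properties as ℤ
open import Data.Integer.Tactic.RingSolver using (solve-∀)
open import Data.List.Base as List using (List; []; _∷_; _++_; _∷ʳ_)
open import Data.List.Membership.Propositional using (find; lose) renaming (_∈_ to _∈ˡ_)
import Data.List.Membership.Propositional.Properties as List
import Data.List.Properties as List
open import Data.List.Relation.Unary.All as All using ([]; _∷_)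
open import Data.List.Relation.Unary.AllPairs as AllPairs using (AllPairs; []; _∷_)
import Data.List.Relation.Unary.AllPairs.Properties as AllPairs
open import Data.List.Relation.Unary.Any using (here; there)
import Data.List.Relation.Unary.Unique.Propositional.Properties as Unique
open import Data.Nat.Base as ℕ using (ℕ; zero; suc; NonTrivial)
import Data.Nat.Divisibility as ℕ
import Data.Nat.DivMod as ℕ
import Data.Nat.Properties as ℕ
open import Data.Product.Base using (Σ-syntax; ∃-syntax; _×_; _,_; proj₁; proj₂)
open import Data.Product using (∃!)
open import Data.Sum.Base as Sum using (_⊎_; inj₁; inj₂)
open import Data.Vec.Base as Vec using (Vec; sum; lookup; _[_]%=_)
import Data.Vec.Properties as Vec
import Data.Vec.Relation.Unary.All as VecAll
open import Data.Vec.Relation.Binary.Pointwise.Inductive as Pointwise using (Pointwise)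
open import Function.Base using (_∘_; flip)
open import Function.Bundles using (Bijection; Inverse)
open import Level using (0ℓ)
open import Relation.Binary.Construct.Closure.ReflexiveTransitive as Star using (Star; ε; _◅_; _◅◅_)
open import Relation.Binary.Bundles using (Setoid)
open import Relation.Binary.Core using (Rel)
open import Relation.Binary.Definitions using (Tri; tri<; tri≈; tri>)
open import Relation.Binary.PropositionalEquality
  using (_≡_; _≢_; refl; sym; trans; cong; cong₂; subst; subst₂; module ≡-Reasoning)
open import Relation.Nullary using (¬_; Dec; yes; no; contradiction)
open import Relation.Nullary.Decidable using (¬?; decidable-stable; _×-dec_; _⊎-dec_; map′; dec-true; dec-false)
open import Relation.Unary using (Pred)

-- Orbits of injective partial maps on finite sets.

module _ {S : Set} {_⇒_ : Rel S 0ℓ} where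

  star-deterministic : (∀ {x y z} → x ⇒ y → x ⇒ z → y ≡ z) →
    ∀ {x y z} → Star _⇒_ x y → Star _⇒_ x z → (∀ {u} → ¬ y ⇒ u) → (∀ {u} → ¬ z ⇒ u) → y ≡ z
  star-deterministic det ε        ε        _    _    = refl
  star-deterministic det ε        (s ◅ _)  stop _    = contradiction s stop
  star-deterministic det (s ◅ _)  ε        _    stop = contradiction s stop
  star-deterministic det (s ◅ ss) (t ◅ ts) p    q with refl ← det s t = star-deterministic det ss ts p q

  -- The states on a path of an injective partial map that starts outside
  -- its image are distinct, so in a finite set such a path ends.
  module _ {N : ℕ} (code : S → Fin N) (code-injective : ∀ {x y} → code x ≡ code y → x ≡ y)
           (codet : ∀ {x y z} → x ⇒ z → y ⇒ z → x ≡ y)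
           {Goal : S → Set} (progress : ∀ {y z} → y ⇒ z → Goal z ⊎ ∃[ u ] z ⇒ u) where

    private
      data Walk (x : S) : ℕ → S → Set where
        []  : Walk x 0 x
        _▷_ : ∀ {k y z} → Walk x k y → y ⇒ z → Walk x (suc k) z

      -- Both walks are peeled from their common end, where `codet` identifies the predecessors; as
      -- nothing precedes `x`, they are exhausted together. So a state is visited at one time only.
      walk-length : ∀ {x j k y} → (∀ {u} → ¬ u ⇒ x) → Walk x j y → Walk x k y → j ≡ k
      walk-length first []      []      = refl
      walk-length first []      (_ ▷ s) = contradiction s first
      walk-length first (_ ▷ s) []      = contradiction s first
      walk-length first (v ▷ s) (w ▷ t) with refl ← codet s t = cong suc (walk-length first v w)

      visited : ∀ {x k y} → Walk x k y → ∀ {j} → j ℕ.≤ k → ∃[ z ] Walk x j z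
      visited {y = y} w j≤k with ℕ.m≤n⇒m<n∨m≡n j≤k
      ... | inj₂ refl = y , w
      visited (w ▷ _) _ | inj₁ (ℕ.s≤s j≤k) = visited w j≤k

      too-long : ∀ {x y} → (∀ {u} → ¬ u ⇒ x) → ¬ Walk x N y
      too-long {x} first w = collision (Fin.pigeonhole (ℕ.n<1+n N) (code ∘ proj₁ ∘ at))
        where
        at : ∀ i → ∃[ z ] Walk x (toℕ i) z
        at i = visited w (Fin.toℕ≤pred[n] i)
        collision : ¬ (∃[ i ] ∃[ j ] i Fin.< j × code (proj₁ (at i)) ≡ code (proj₁ (at j)))
        collision (i , j , i<j , e) = ℕ.<-irrefl
          (walk-length first (proj₂ (at i)) (subst (Walk x (toℕ j)) (sym (code-injective e)) (proj₂ (at j)))) i<j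

      -- The walk has `k` steps and `fuel + k` is the number of codes, so once the fuel is spent the
      -- walk itself is refuted by `too-long`.
      search : ∀ {x y} → (∀ {u} → ¬ u ⇒ x) → ∀ fuel k → fuel ℕ.+ k ≡ N → Walk x k y → Star _⇒_ x y →
               Goal y ⊎ ∃[ u ] y ⇒ u → ∃[ z ] Star _⇒_ x z × Goal z
      search first _ _ _ _ path (inj₁ g) = _ , path , g
      search first zero k refl w _ (inj₂ _) = contradiction w (too-long first)
      search first (suc fuel) k e w path (inj₂ (_ , s)) =
        search first fuel (suc k) (trans (ℕ.+-suc fuel k) e) (w ▷ s) (path ◅◅ s ◅ ε) (progress s)

    reaches-goal : ∀ {x} → (∀ {u} → ¬ u ⇒ x) → Goal x ⊎ ∃[ u ] x ⇒ u → ∃[ z ] Star _⇒_ x z × Goal z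
    reaches-goal first = search first N 0 (ℕ.+-identityʳ N) [] ε

-- Coding tuples of subsets by a finite set.

module _ {A : Set} {k : ℕ} (code : A → Fin k) where

  code-vec : ∀ {m} → Vec A m → Fin (k ℕ.^ m)
  code-vec Vec.[]       = Fin.zero
  code-vec (x Vec.∷ xs) = Fin.combine (code x) (code-vec xs)

  code-vec-injective : (∀ {x y} → code x ≡ code y → x ≡ y) →
    ∀ {m} {xs ys : Vec A m} → code-vec xs ≡ code-vec ys → xs ≡ ys
  code-vec-injective inj {xs = Vec.[]}     {Vec.[]}     _ = refl
  code-vec-injective inj {xs = x Vec.∷ xs} {y Vec.∷ ys} e with e₁ , e₂ ← Fin.combine-injective (code x) _ (code y) _ e =
    cong₂ Vec._∷_ (inj e₁) (code-vec-injective inj e₂)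

module _ {n : ℕ} where
  open Inverse Fin.2↔Bool using (to; from; strictlyInverseˡ)

  code-subset : Subset n → Fin (2 ℕ.^ n)
  code-subset = code-vec from

  code-subset-injective : ∀ {A B} → code-subset A ≡ code-subset B → A ≡ B
  code-subset-injective = code-vec-injective from λ {x} {y} e →
    trans (sym (strictlyInverseˡ x)) (trans (cong to e) (strictlyInverseˡ y))

-- Inequalities between integers.

≤-by-difference : ∀ {a b c d} → a ≤ b → b - a ≡ d - c → c ≤ d
≤-by-difference p eq = ℤ.0≤i-j⇒j≤i (subst (0ℤ ≤_) eq (ℤ.i≤j⇒0≤j-i p))

<⇒+1≤ : ∀ {x y} → x < y → x + 1ℤ ≤ y
<⇒+1≤ {x} {y} p = subst (_≤ y) (ℤ.+-comm 1ℤ x) (ℤ.i<j⇒suc[i]≤j p)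

+1≤⇒< : ∀ {x y} → x + 1ℤ ≤ y → x < y
+1≤⇒< {x} {y} p = ℤ.suc[i]≤j⇒i<j (subst (_≤ y) (ℤ.+-comm x 1ℤ) p)

<⇒≤-1 : ∀ {x y} → x < y → x ≤ y - 1ℤ
<⇒≤-1 {x} {y} p = ≤-by-difference (<⇒+1≤ p) (lem x y)
  where
  lem : ∀ x y → y - (x + 1ℤ) ≡ y - 1ℤ - x
  lem = solve-∀

≤-1⇒< : ∀ {x y} → x ≤ y - 1ℤ → x < y
≤-1⇒< {x} {y} p = +1≤⇒< (≤-by-difference p (lem x y))
  where
  lem : ∀ x y → y - 1ℤ - x ≡ y - (x + 1ℤ)
  lem = solve-∀

-1<⇒≤ : ∀ {x y} → x - 1ℤ < y → x ≤ y
-1<⇒≤ {x} {y} p = ≤-by-difference (<⇒+1≤ p) (lem x y)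
  where
  lem : ∀ x y → y - (x - 1ℤ + 1ℤ) ≡ y - x
  lem = solve-∀

≤⇒-1< : ∀ {x y} → x ≤ y → x - 1ℤ < y
≤⇒-1< {x} {y} p = +1≤⇒< (≤-by-difference p (lem x y))
  where
  lem : ∀ x y → y - x ≡ y - (x - 1ℤ + 1ℤ)
  lem = solve-∀

-1-mono-< : ∀ {x y} → x < y → x - 1ℤ < y - 1ℤ
-1-mono-< p = ≤⇒-1< (<⇒≤-1 p)

<+1⇒≤ : ∀ {x y} → x < y + 1ℤ → x ≤ y
<+1⇒≤ {x} {y} p = ≤-by-difference (<⇒≤-1 p) (lem x y)
  where
  lem : ∀ x y → y + 1ℤ - 1ℤ - x ≡ y - x
  lem = solve-∀

x-1<x : ∀ x → x - 1ℤ < x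
x-1<x x = ≤⇒-1< ℤ.≤-refl

x<x+1 : ∀ x → x < x + 1ℤ
x<x+1 x = +1≤⇒< ℤ.≤-refl

-1+1 : ∀ x → x - 1ℤ + 1ℤ ≡ x
-1+1 = solve-∀

+1-1 : ∀ x → x + 1ℤ - 1ℤ ≡ x
+1-1 = solve-∀

≤-cases : ∀ {x y} → x ≤ y → x ≡ y ⊎ x < y
≤-cases {x} {y} p with x ℤ.≟ y
... | yes e = inj₁ e
... | no  e = inj₂ (ℤ.≤∧≢⇒< p e)

≤⇒+ℕ : ∀ {x y} → x ≤ y → ∃[ d ] y ≡ x + + d
≤⇒+ℕ {x} {y} p with y - x in eq | ℤ.i≤j⇒0≤j-i p
... | + d | _ = d , trans (lem x y) (cong (λ z → x + z) eq)
  where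
  lem : ∀ x y → y ≡ x + (y - x)
  lem = solve-∀

-- Residues modulo n.

module Residues (n : ℕ) .{{_ : NonTrivial n}} where
  open AffineSymmetric n

  2≤n : 2 ℕ.≤ n
  2≤n = ℕ.nonTrivial⇒n>1 n

  ≡ₙ-reflexive : ∀ {x y} → x ≡ y → x ≡ₙ y
  ≡ₙ-reflexive refl = ≡ₙ-refl

  ≡ₙ-+ : ∀ c {x y} → x ≡ₙ y → x + c ≡ₙ y + c
  ≡ₙ-+ c {x} {y} = map-≡ₙ (_+ c) λ i → lem i (+ n) c
    where
    lem : ∀ x n c → x + n + c ≡ x + c + n
    lem = solve-∀

  ≡ₙ-cancel-+ : ∀ c {x y} → x + c ≡ₙ y + c → x ≡ₙ y
  ≡ₙ-cancel-+ c {x} {y} p = subst₂ _≡ₙ_ (lem x c) (lem y c) (≡ₙ-+ (- c) p)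
    where
    lem : ∀ x c → x + c + - c ≡ x
    lem = solve-∀

  ≡ₙ-gap : ∀ {x y} → x ≡ₙ y → x < y → x + + n ≤ y
  ≡ₙ-gap {x} {y} p x<y with d , refl ← ≤⇒+ℕ (ℤ.<⇒≤ x<y) = ℤ.+-monoʳ-≤ x (+≤+ (n≤ d n∣d d≢0))
    where
    lem : ∀ x d → x + d - x ≡ d
    lem = solve-∀
    n∣d : n ℕ.∣ d
    n∣d = ∣⇒∣ᵤ (subst (+ n ∣_) (lem x (+ d)) (_≡ₙ_.n∣x-y (≡ₙ-sym p)))
    d≢0 : d ≢ 0
    d≢0 refl = ℤ.<-irrefl (sym (ℤ.+-identityʳ x)) x<y
    n≤ : ∀ d → n ℕ.∣ d → d ≢ 0 → n ℕ.≤ d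
    n≤ zero    _ d≢0 = contradiction refl d≢0
    n≤ (suc d) n∣d _ = ℕ.∣⇒≤ n∣d

  1+x≤x+n : ∀ x → x + 1ℤ ≤ x + + n
  1+x≤x+n x = ℤ.+-monoʳ-≤ x (+≤+ (ℕ.≤-trans (ℕ.n≤1+n 1) 2≤n))

  x<x+n : ∀ x → x < x + + n
  x<x+n x = +1≤⇒< (1+x≤x+n x)

  2+x≤x+n : ∀ x → x + 1ℤ + 1ℤ ≤ x + + n
  2+x≤x+n x = subst (_≤ x + + n) (lem x) (ℤ.+-monoʳ-≤ x (+≤+ 2≤n))
    where
    lem : ∀ x → x + (1ℤ + 1ℤ) ≡ x + 1ℤ + 1ℤ
    lem = solve-∀

  %ℕ-≡ₙ : ∀ x → + (x %ℕ n) ≡ₙ x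
  %ℕ-≡ₙ x = congruent (divides (- (x /ℕ n)) (trans
    (cong (λ z → + (x %ℕ n) - z) (a≡a%ℕn+[a/ℕn]*n x n)) (lem (+ (x %ℕ n)) (x /ℕ n) (+ n))))
    where
    lem : ∀ k q n → k - (k + q * n) ≡ - q * n
    lem = solve-∀

  abstract
    -- Residues run through 0, ..., n-1, as the indices of `simple` do, whereas `residue` counts
    -- from the start of the window. The definition is opaque: later proofs rely on `⌊⌋-≡ₙ` alone.
    ⌊_⌋ : ℤ → Fin n
    ⌊ x ⌋ = fromℕ< (n%ℕd<d x n)

    ⌊⌋-≡ₙ : ∀ x → + toℕ ⌊ x ⌋ ≡ₙ x
    ⌊⌋-≡ₙ x = ≡ₙ-trans (≡ₙ-reflexive (cong +_ (Fin.toℕ-fromℕ< _))) (%ℕ-≡ₙ x)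

  toℕ-≡ₙ-injective : ∀ {i j : Fin n} → + toℕ i ≡ₙ + toℕ j → i ≡ j
  toℕ-≡ₙ-injective {i} {j} p =
    window-injective (subst₂ _≡ₙ_ (ℤ.+-comm (+ toℕ i) 1ℤ) (ℤ.+-comm (+ toℕ j) 1ℤ) (≡ₙ-+ 1ℤ p))

  ⌊⌋-cong : ∀ {x y} → x ≡ₙ y → ⌊ x ⌋ ≡ ⌊ y ⌋
  ⌊⌋-cong {x} {y} p = toℕ-≡ₙ-injective (≡ₙ-trans (⌊⌋-≡ₙ x) (≡ₙ-trans p (≡ₙ-sym (⌊⌋-≡ₙ y))))

  ⌊⌋-injective : ∀ {x y} → ⌊ x ⌋ ≡ ⌊ y ⌋ → x ≡ₙ y
  ⌊⌋-injective {x} {y} p =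
    ≡ₙ-trans (≡ₙ-sym (⌊⌋-≡ₙ x)) (subst (λ i → + toℕ i ≡ₙ y) (sym p) (⌊⌋-≡ₙ y))

  ⌊⌋-toℕ : ∀ i → ⌊ + toℕ i ⌋ ≡ i
  ⌊⌋-toℕ i = toℕ-≡ₙ-injective (⌊⌋-≡ₙ (+ toℕ i))

  ⌊⌋-+n : ∀ x → ⌊ x + + n ⌋ ≡ ⌊ x ⌋
  ⌊⌋-+n x = ⌊⌋-cong (x+n≡ₙx x)

  mod-≡ₙ : ∀ k → + toℕ (k ℕ.mod n) ≡ₙ + k
  mod-≡ₙ k = ≡ₙ-trans (≡ₙ-reflexive (cong +_ (Fin.toℕ-fromℕ< _))) (%ℕ-≡ₙ (+ k))

  next-⌊⌋ : ∀ x → next ⌊ x ⌋ ≡ ⌊ x + 1ℤ ⌋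
  next-⌊⌋ x = toℕ-≡ₙ-injective (≡ₙ-trans (mod-≡ₙ (toℕ ⌊ x ⌋ ℕ.+ 1))
    (≡ₙ-trans (≡ₙ-+ 1ℤ (⌊⌋-≡ₙ x)) (≡ₙ-sym (⌊⌋-≡ₙ (x + 1ℤ)))))

  prev-⌊⌋ : ∀ x → prev ⌊ x ⌋ ≡ ⌊ x - 1ℤ ⌋
  prev-⌊⌋ x = toℕ-≡ₙ-injective (≡ₙ-trans (mod-≡ₙ (toℕ ⌊ x ⌋ ℕ.+ (n ℕ.∸ 1)))
    (≡ₙ-trans (≡ₙ-trans (≡ₙ-+ (+ (n ℕ.∸ 1)) (⌊⌋-≡ₙ x)) -1≡)
      (≡ₙ-sym (⌊⌋-≡ₙ (x - 1ℤ)))))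
    where
    lem : ∀ x n → x + (n - 1ℤ) ≡ x - 1ℤ + n
    lem = solve-∀
    n-1 : + (n ℕ.∸ 1) ≡ + n - 1ℤ
    n-1 = sym (trans (ℤ.m-n≡m⊖n n 1) (ℤ.⊖-≥ (ℕ.≤-trans (ℕ.n≤1+n 1) 2≤n)))
    -1≡ : x + + (n ℕ.∸ 1) ≡ₙ x - 1ℤ
    -1≡ = ≡ₙ-trans (≡ₙ-reflexive (trans (cong (λ z → x + z) n-1) (lem x (+ n)))) (x+n≡ₙx (x - 1ℤ))

  ≡ₙ-neg : ∀ {x y} → x ≡ₙ y → - x ≡ₙ - y
  ≡ₙ-neg {x} {y} p = congruent (subst (+ n ∣_) (lem x y) (_≡ₙ_.n∣x-y (≡ₙ-sym p)))
    where
    lem : ∀ x y → y - x ≡ - x - - y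
    lem = solve-∀

  abstract
    -- Here and in `representative⁻`, the distance `d` is the fuel for a search that walks from `x`
    -- towards a residue outside a proper subset.
    representative : ∀ x c → ∃[ d ] ⌊ x + + d ⌋ ≡ ⌊ c ⌋
    representative x c = (c - x) %ℕ n , ⌊⌋-cong (subst₂ _≡ₙ_ (ℤ.+-comm (+ ((c - x) %ℕ n)) x) (lem c x)
      (≡ₙ-+ x (%ℕ-≡ₙ (c - x))))
      where
      lem : ∀ c x → c - x + x ≡ c
      lem = solve-∀

    representative⁻ : ∀ x c → ∃[ d ] ⌊ x - + d ⌋ ≡ ⌊ c ⌋
    representative⁻ x c = negate (representative (- x) (- c))
      where
      lem : ∀ x d → - (- x + d) ≡ x - d
      lem = solve-∀
      negate : (∃[ d ] ⌊ - x + + d ⌋ ≡ ⌊ - c ⌋) → ∃[ d ] ⌊ x - + d ⌋ ≡ ⌊ c ⌋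
      negate (d , eq) = d , ⌊⌋-cong (subst₂ _≡ₙ_ (lem x (+ d)) (ℤ.neg-involutive c)
        (≡ₙ-neg (⌊⌋-injective eq)))

-- The action of cyclically decreasing elements on the integers.

module Moving (n : ℕ) .{{_ : NonTrivial n}} where
  open AffineSymmetric n
  open S̃ using (apply)
  open Residues n

  Segment : Pred (Fin n) 0ℓ → ℤ → ℤ → Set
  Segment P x y = ∀ {z} → x ≤ z → z < y → P ⌊ z ⌋

  -- An initial part of a maximal interval, possibly empty; `y` may still be in `P`. A predicate is
  -- used in place of a subset so that `P` can also be membership in a word.
  record Block (P : Pred (Fin n) 0ℓ) (x y : ℤ) : Set where
    constructor block
    field
      start   : ¬ P ⌊ x - 1ℤ ⌋
      segment : Segment P x y

  open Block public

  -- The effect of w⟨ A ⟩ on x, for P the membership in A.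
  data Moves (P : Pred (Fin n) 0ℓ) (x : ℤ) : ℤ → Set where
    down : P ⌊ x - 1ℤ ⌋ → Moves P x (x - 1ℤ)
    up   : ∀ {y} → x ≤ y → Block P x y → ¬ P ⌊ y ⌋ → Moves P x y

  module _ (P : Pred (Fin n) 0ℓ) where

    segment-empty : ∀ x → Segment P x x
    segment-empty x x≤z z<x = contradiction (ℤ.≤-<-trans x≤z z<x) (ℤ.<-irrefl refl)

    segment-snoc : ∀ {x y} → Segment P x y → P ⌊ y ⌋ → Segment P x (y + 1ℤ)
    segment-snoc {x} {y} seg p {z} x≤z z<y+1 with ≤-cases (<+1⇒≤ {z} {y} z<y+1)
    ... | inj₁ refl = p
    ... | inj₂ z<y  = seg x≤z z<y

    segment-cons : ∀ {x y} → P ⌊ x ⌋ → Segment P (x + 1ℤ) y → Segment P x y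
    segment-cons p seg x≤z z<y with ≤-cases x≤z
    ... | inj₁ refl = p
    ... | inj₂ x<z  = seg (<⇒+1≤ x<z) z<y

  module _ {P : Pred (Fin n) 0ℓ} where

    P-cong : ∀ {x y} → x ≡ₙ y → P ⌊ x ⌋ → P ⌊ y ⌋
    P-cong p = subst P (⌊⌋-cong p)

    -- The gap at x - 1 recurs at x - 1 + n, so a block cannot reach that far. The bound on `a`
    -- admits the gap itself, which is needed for the lowest letter of an interval.
    block-≢ₙ : ∀ {x y a b} → Block P x y → x - 1ℤ ≤ a → a < b → b < y → a ≢ₙ b
    block-≢ₙ {x} {y} {a} {b} B x≤a a<b b<y a≡b = start B (P-cong (x+n≡ₙx (x - 1ℤ))
      (segment B (-1<⇒≤ (x<x+n (x - 1ℤ)))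
        (ℤ.≤-<-trans (ℤ.≤-trans (ℤ.+-monoˡ-≤ (+ n) x≤a) (≡ₙ-gap a≡b a<b)) b<y)))

    block-shrink : ∀ {x y z} → Block P x y → z ≤ y → Block P x z
    block-shrink (block s seg) z≤y = block s λ x≤a a<z → seg x≤a (ℤ.<-≤-trans a<z z≤y)

    block-shift : ∀ {x y} k → x + k ≡ₙ x → Block P x y → Block P (x + k) (y + k)
    block-shift {x} {y} k k≡ (block s seg) = block
      (s ∘ P-cong (≡ₙ-+ (- 1ℤ) k≡))
      λ {z} x+k≤z z<y+k → P-cong (z-k≡z z)
        (seg (subst (_≤ z - k) (lem′ x k) (ℤ.+-monoˡ-≤ (- k) x+k≤z))
             (subst (z - k <_) (lem′ y k) (ℤ.+-monoˡ-< (- k) z<y+k)))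
      where
      lem′ : ∀ x k → x + k - k ≡ x
      lem′ = solve-∀
      lem₁ : ∀ x z k → x + (z - k - x) ≡ z - k
      lem₁ = solve-∀
      lem₂ : ∀ x z k → x + k + (z - k - x) ≡ z
      lem₂ = solve-∀
      z-k≡z : ∀ z → z - k ≡ₙ z
      z-k≡z z = subst₂ _≡ₙ_ (lem₁ x z k) (lem₂ x z k) (≡ₙ-+ (z - k - x) (≡ₙ-sym k≡))

    -- Since `Moves` is the graph of a function, an image under `w⟨ A ⟩` is computed by exhibiting a
    -- move; `delete-arc` and `singleton-≈` work this way.
    moves-functional : ∀ {x y z} → Moves P x y → Moves P x z → y ≡ z
    moves-functional (down p) (down q) = refl
    moves-functional (down p) (up _ B _) = contradiction p (start B)
    moves-functional (up _ B _) (down q) = contradiction q (start B)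
    moves-functional {y = y} {z} (up x≤y B y∉) (up x≤z C z∉) with ℤ.<-cmp y z
    ... | tri< y<z _ _ = contradiction (segment C x≤y y<z) y∉
    ... | tri≈ _ y≡z _ = y≡z
    ... | tri> _ _ z<y = contradiction (segment B x≤z z<y) z∉

    block-start-≤ : ∀ {x x′ y} → x ≤ y → Block P x (y + 1ℤ) → Block P x′ (y + 1ℤ) → x ≤ x′
    block-start-≤ {x} {x′} {y} x≤y B C = ℤ.≮⇒≥ λ x′<x →
      start B (segment C (<⇒≤-1 x′<x) (ℤ.<-trans (≤⇒-1< x≤y) (x<x+1 y)))

    -- Translating the second block by y - y′ gives both the same top. If one start were lower, its
    -- block would contain the gap below the other start.
    block-start-unique : ∀ {x x′ y y′} → x ≤ y → x′ ≤ y′ →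
      Block P x (y + 1ℤ) → Block P x′ (y′ + 1ℤ) → y ≡ₙ y′ → ⌊ x ⌋ ≡ ⌊ x′ ⌋
    block-start-unique {x} {x′} {y} {y′} x≤y x′≤y′ B C y≡y′ =
      trans (cong ⌊_⌋ (ℤ.≤-antisym (block-start-≤ x≤y B C′) (block-start-≤ x″≤y C′ B)))
            (⌊⌋-cong x″≡x′)
      where
      k = y - y′
      lem : ∀ x y y′ → y + (x - y′) ≡ x + (y - y′)
      lem = solve-∀
      lem′ : ∀ x y → y + (x - y) ≡ x
      lem′ = solve-∀
      lem″ : ∀ y y′ → y′ + 1ℤ + (y - y′) ≡ y + 1ℤ
      lem″ = solve-∀
      x″≡x′ : x′ + k ≡ₙ x′
      x″≡x′ = subst₂ _≡ₙ_ (lem x′ y y′) (lem′ x′ y′) (≡ₙ-+ (x′ - y′) y≡y′)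
      x″≤y : x′ + k ≤ y
      x″≤y = subst (x′ + k ≤_) (lem′ y y′) (ℤ.+-monoˡ-≤ k x′≤y′)
      C′ : Block P (x′ + k) (y + 1ℤ)
      C′ = subst (Block P (x′ + k)) (lem″ y y′) (block-shift k x″≡x′ C)

  moves-ext : ∀ {P Q : Pred (Fin n) 0ℓ} → (∀ {c} → P c → Q c) → (∀ {c} → Q c → P c) →
    ∀ {x y} → Moves P x y → Moves Q x y
  moves-ext f g (down p) = down (f p)
  moves-ext f g (up x≤y (block s seg) y∉) =
    up x≤y (block (s ∘ g) λ a b → f (seg a b)) (y∉ ∘ g)

  simple-up : ∀ {i} y → ⌊ y ⌋ ≡ i → apply (simple i) y ≡ y + 1ℤ
  simple-up y refl = trans (cong (λ z → y + z) (shift-r r _ (≡ₙ-sym (⌊⌋-≡ₙ y)))) (lem y r)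
    where
    r = + toℕ ⌊ y ⌋
    lem : ∀ y r → y + (r + 1ℤ - r) ≡ y + 1ℤ
    lem = solve-∀

  simple-down : ∀ {i} y → ⌊ y - 1ℤ ⌋ ≡ i → apply (simple i) y ≡ y - 1ℤ
  simple-down y refl = trans (cong (λ z → y + z) (shift-s r _ (x≢ₙx+1 r) y≡)) (lem y r)
    where
    r = + toℕ ⌊ y - 1ℤ ⌋
    y≡ : y ≡ₙ r + 1ℤ
    y≡ = subst (_≡ₙ r + 1ℤ) (-1+1 y) (≡ₙ-+ 1ℤ (≡ₙ-sym (⌊⌋-≡ₙ (y - 1ℤ))))
    lem : ∀ y r → y + (r - (r + 1ℤ)) ≡ y - 1ℤ
    lem = solve-∀

  simple-fix : ∀ {i} y → ⌊ y ⌋ ≢ i → ⌊ y - 1ℤ ⌋ ≢ i → apply (simple i) y ≡ y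
  simple-fix {i} y p q = trans (cong (λ z → y + z) (shift-other r _ y≢ y-1≢)) (ℤ.+-identityʳ y)
    where
    r = + toℕ i
    y≢ : y ≢ₙ r
    y≢ e = p (trans (⌊⌋-cong e) (⌊⌋-toℕ i))
    y-1≢ : y ≢ₙ r + 1ℤ
    y-1≢ e = q (trans (⌊⌋-cong (subst (y - 1ℤ ≡ₙ_) (+1-1 r) (≡ₙ-+ (- 1ℤ) e))) (⌊⌋-toℕ i))

  module _ {P Q : Pred (Fin n) 0ℓ} {i : Fin n} (Q⇒ : ∀ {c} → Q c → c ≡ i ⊎ P c)
           (Qi : Q i) (P⇒Q : ∀ {c} → P c → Q c) (i∉ : ¬ P i) (next∉ : ¬ P (next i)) where

    private
      ¬Q : ∀ {c} → c ≢ i → ¬ P c → ¬ Q c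
      ¬Q c≢i c∉ q with Q⇒ q
      ... | inj₁ e = c≢i e
      ... | inj₂ p = c∉ p

      next∉⌊⌋ : ∀ {x} → ⌊ x ⌋ ≡ i → ¬ P ⌊ x + 1ℤ ⌋
      next∉⌊⌋ {x} refl p = next∉ (subst P (sym (next-⌊⌋ x)) p)

      next∉⌊⌋′ : ∀ {x} → ⌊ x - 1ℤ ⌋ ≡ i → ¬ P ⌊ x ⌋
      next∉⌊⌋′ {x} eq p = next∉⌊⌋ eq (subst (P ∘ ⌊_⌋) (sym (-1+1 x)) p)

    -- The letter i is put in front. If y ≡ i, the climb from x goes on by one step and ends there,
    -- as i + 1 is absent. If y - 1 ≡ i, then y = x, since a longer climb would have used i, and x
    -- now descends. All other images, in particular those of descending x, are fixed by the
    -- reflection.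
    moves-cons : ∀ {x y} → Moves P x y → Moves Q x (apply (simple i) y)
    moves-cons {x} (down p) = subst (Moves Q x) (sym (simple-fix (x - 1ℤ)
      (λ { refl → i∉ p })
      (λ e → next∉⌊⌋′ e p))) (down (P⇒Q p))
    moves-cons {x} {y} (up x≤y B@(block s seg) y∉) with ⌊ y ⌋ Fin.≟ i | ⌊ y - 1ℤ ⌋ Fin.≟ i
    ... | yes y≡i | _ = subst (Moves Q x) (sym (simple-up y y≡i))
      (up (ℤ.≤-trans x≤y (ℤ.<⇒≤ (x<x+1 y)))
          (block (¬Q x-1≢i s) (segment-snoc Q (λ a b → P⇒Q (seg a b)) (subst Q (sym y≡i) Qi)))
          (¬Q y+1≢i (next∉⌊⌋ y≡i)))
      where
      y+1≢i : ⌊ y + 1ℤ ⌋ ≢ i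
      y+1≢i e = x≢ₙx+1 y (⌊⌋-injective (trans y≡i (sym e)))
      x-1≢i : ⌊ x - 1ℤ ⌋ ≢ i
      -- Both x - 1 and y would be congruent to i, so y ≥ x - 1 + n ≥ x + 1 because n ≥ 2. Then x is
      -- in the segment, although x ≡ i + 1.
      x-1≢i e = next∉⌊⌋′ e (seg ℤ.≤-refl
        (+1≤⇒< (ℤ.≤-trans (subst (λ z → z + 1ℤ ≤ x - 1ℤ + + n) (-1+1 x) (2+x≤x+n (x - 1ℤ)))
          (≡ₙ-gap (⌊⌋-injective (trans e (sym y≡i))) (≤⇒-1< x≤y)))))
    ... | no y≢i | yes y-1≡i with ≤-cases x≤y
    ...   | inj₁ refl = subst (Moves Q x) (sym (simple-down y y-1≡i)) (down (subst Q (sym y-1≡i) Qi))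
    ...   | inj₂ x<y  = contradiction (subst P y-1≡i (seg (<⇒≤-1 x<y) (x-1<x y))) i∉
    moves-cons {x} {y} (up x≤y B@(block s seg) y∉) | no y≢i | no y-1≢i =
      subst (Moves Q x) (sym (simple-fix y y≢i y-1≢i))
        (up x≤y (block (¬Q x-1≢i s) (λ a b → P⇒Q (seg a b))) (¬Q y≢i y∉))
      where
      x-1≢i : ⌊ x - 1ℤ ⌋ ≢ i
      x-1≢i e with ≤-cases x≤y
      ... | inj₁ refl = y-1≢i e
      ... | inj₂ x<y  = next∉⌊⌋′ e (seg ℤ.≤-refl x<y)

  -- i may precede j in a cyclically decreasing word
  _▹_ : Fin n → Fin n → Set
  i ▹ j = j ≢ i × j ≢ next i

  decreasing-moves : ∀ {W} → AllPairs _▹_ W → ∀ x → Moves (_∈ˡ W) x (apply ⟦ W ⟧ x)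
  decreasing-moves []             x = up ℤ.≤-refl (block (λ ()) (segment-empty (_∈ˡ []) x)) λ ()
  decreasing-moves {i ∷ W} (i▹ ∷ ps) x =
    moves-cons (λ { (here e) → inj₁ e ; (there p) → inj₂ p }) (here refl) there
      (λ p → proj₁ (All.lookup i▹ p) refl) (λ p → proj₂ (All.lookup i▹ p) refl)
      (decreasing-moves ps x)

  -- The descent from `y` must leave the proper subset `A`. This makes every letter of `A` the top
  -- letter of an arc.
  block-below : ∀ {A} → A ⊂ ⊤ → ∀ {y} → ⌊ y ⌋ ∈ A → ∃[ x ] x ≤ y × Block (_∈ A) x (y + 1ℤ)
  block-below {A} (_ , c , _ , c∉) {y} y∈ with d , e ← representative⁻ y (+ toℕ c) =
    search d y (c∉ ∘ subst (_∈ A) (trans e (⌊⌋-toℕ c))) y∈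
    where
    lem : ∀ y d → y - (1ℤ + d) ≡ y - 1ℤ - d
    lem = solve-∀
    search : ∀ d y → ⌊ y - + d ⌋ ∉ A → ⌊ y ⌋ ∈ A → ∃[ x ] x ≤ y × Block (_∈ A) x (y + 1ℤ)
    search zero y y∉ y∈ = contradiction (subst (λ z → ⌊ z ⌋ ∈ A) (sym (ℤ.+-identityʳ y)) y∈) y∉
    search (suc d) y y∉ y∈ with ⌊ y - 1ℤ ⌋ ∈? A
    ... | no y-1∉ = y , ℤ.≤-refl , block y-1∉ (segment-snoc (_∈ A) (segment-empty (_∈ A) y) y∈)
    ... | yes y-1∈ with x , x≤ , B ← search d (y - 1ℤ) (y∉ ∘ subst (λ z → ⌊ z ⌋ ∈ A) (sym (lem y (+ d)))) y-1∈ =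
      x , ℤ.≤-trans x≤ (ℤ.<⇒≤ (x-1<x y)) , block (start B) (segment-snoc (_∈ A) (subst (Segment (_∈ A) x) (-1+1 y) (segment B)) y∈)

  segment-above : ∀ {A} → A ⊂ ⊤ → ∀ x → ∃[ y ] x ≤ y × Segment (_∈ A) x y × ⌊ y ⌋ ∉ A
  segment-above {A} (_ , c , _ , c∉) x with d , e ← representative x (+ toℕ c) =
    search d x (c∉ ∘ subst (_∈ A) (trans e (⌊⌋-toℕ c)))
    where
    lem : ∀ x d → x + (1ℤ + d) ≡ x + 1ℤ + d
    lem = solve-∀
    search : ∀ d x → ⌊ x + + d ⌋ ∉ A → ∃[ y ] x ≤ y × Segment (_∈ A) x y × ⌊ y ⌋ ∉ A
    search d x x∉ with ⌊ x ⌋ ∈? A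
    search d x x∉ | no z∉ = x , ℤ.≤-refl , segment-empty (_∈ A) x , z∉
    search zero x x∉ | yes z∈ = contradiction (subst (λ z → ⌊ z ⌋ ∈ A) (sym (ℤ.+-identityʳ x)) z∈) x∉
    search (suc d) x x∉ | yes z∈
      with y , x≤y , seg , y∉ ← search d (x + 1ℤ) (x∉ ∘ subst (λ z → ⌊ z ⌋ ∈ A) (sym (lem x (+ d)))) =
      y , ℤ.≤-trans (ℤ.<⇒≤ (x<x+1 x)) x≤y , segment-cons (_∈ A) z∈ seg , y∉

-- Removal, insertion and cardinality in subsets.

∖-size : ∀ {n} (A : Subset n) {c} → c ∈ A → suc (card (A ∖ c)) ≡ card A
∖-size (_ Vec.∷ A) Vec.here = cong (suc ∘ card) (Subset.p─⊥≡p A)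
∖-size (outside Vec.∷ A) (Vec.there c∈) = ∖-size A c∈
∖-size (inside Vec.∷ A) (Vec.there c∈) = cong suc (∖-size A c∈)

module _ {n : ℕ} where

  ∈-∖⁻ : ∀ (A : Subset n) {c d} → d ∈ A ∖ c → d ∈ A × d ≢ c
  ∈-∖⁻ A {c} d∈ = Subset.p─q⊆p A _ d∈ , λ { refl → x∉p-x A c d∈ }
    where
    x∉p-x : ∀ {n} (p : Subset n) x → x ∉ p ∖ x
    x∉p-x (_ Vec.∷ p) (Fin.suc x) (Vec.there x∈) = x∉p-x p x x∈

  ∈-∪⁅⁆⁻ : ∀ (A : Subset n) {c d} → d ∈ A ∪ ⁅ c ⁆ → d ∈ A ⊎ d ≡ c
  ∈-∪⁅⁆⁻ A {c} d∈ with Subset.x∈p∪q⁻ A ⁅ c ⁆ d∈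
  ... | inj₁ d∈A = inj₁ d∈A
  ... | inj₂ d∈c = inj₂ (Subset.x∈⁅y⁆⇒x≡y c d∈c)

  insert-∖ : ∀ (A : Subset n) {c} → c ∉ A → A ∪ ⁅ c ⁆ ∖ c ≡ A
  insert-∖ A {c} c∉ = Subset.⊆-antisym to from
    where
    to : ∀ {d} → d ∈ A ∪ ⁅ c ⁆ ∖ c → d ∈ A
    to d∈ with d∈′ , d≢c ← ∈-∖⁻ (A ∪ ⁅ c ⁆) d∈ with ∈-∪⁅⁆⁻ A d∈′
    ... | inj₁ d∈A = d∈A
    ... | inj₂ d≡c = contradiction d≡c d≢c
    from : ∀ {d} → d ∈ A → d ∈ A ∪ ⁅ c ⁆ ∖ c
    from d∈ = Subset.x∈p∧x≢y⇒x∈p-y (Subset.x∈p∪q⁺ (inj₁ d∈)) λ { refl → c∉ d∈ }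

  ∖-insert : ∀ (A : Subset n) {c} → c ∈ A → (A ∖ c) ∪ ⁅ c ⁆ ≡ A
  ∖-insert A {c} c∈ = Subset.⊆-antisym to from
    where
    to : ∀ {d} → d ∈ (A ∖ c) ∪ ⁅ c ⁆ → d ∈ A
    to d∈ with ∈-∪⁅⁆⁻ (A ∖ c) d∈
    ... | inj₁ d∈A  = proj₁ (∈-∖⁻ A d∈A)
    ... | inj₂ refl = c∈
    from : ∀ {d} → d ∈ A → d ∈ (A ∖ c) ∪ ⁅ c ⁆
    from {d} d∈ with d Fin.≟ c
    ... | yes refl = Subset.x∈p∪q⁺ (inj₂ (Subset.x∈⁅x⁆ c))
    ... | no d≢c   = Subset.x∈p∪q⁺ (inj₁ (Subset.x∈p∧x≢y⇒x∈p-y d∈ d≢c))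

  insert-size : ∀ (A : Subset n) {c} → c ∉ A → card (A ∪ ⁅ c ⁆) ≡ suc (card A)
  insert-size A {c} c∉ = trans (sym (∖-size (A ∪ ⁅ c ⁆) (Subset.x∈p∪q⁺ (inj₂ (Subset.x∈⁅x⁆ c)))))
    (cong (suc ∘ card) (insert-∖ A c∉))

  list-size : ∀ (W : List (Fin n)) (A : Subset n) → AllPairs _≢_ W →
    (∀ {c} → c ∈ˡ W → c ∈ A) → (∀ {c} → c ∈ A → c ∈ˡ W) → List.length W ≡ card A
  list-size [] A _ _ A⊆W = sym (trans (cong card A≡⊥) (Subset.∣⊥∣≡0 n))
    where
    A≡⊥ : A ≡ ⊥
    A≡⊥ = Subset.⊆-antisym (λ c∈ → contradiction (A⊆W c∈) λ ()) λ c∈ → contradiction c∈ Subset.∉⊥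
  list-size (c ∷ W) A (c≢ ∷ W≢) W⊆A A⊆W = trans
    (cong suc (list-size W (A ∖ c) W≢
      (λ d∈ → Subset.x∈p∧x≢y⇒x∈p-y (W⊆A (there d∈)) (All.lookup c≢ d∈ ∘ sym))
      (λ d∈ → rest (∈-∖⁻ A d∈))))
    (∖-size A (W⊆A (here refl)))
    where
    rest : ∀ {d} → d ∈ A × d ≢ c → d ∈ˡ W
    rest (d∈ , d≢c) with A⊆W d∈
    ... | here d≡c  = contradiction d≡c d≢c
    ... | there d∈′ = d∈′

-- The defining word of a cyclically decreasing element.

module Words (n : ℕ) .{{_ : NonTrivial n}} where
  open AffineSymmetric n
  open S̃ using (apply)
  open Residues n
  open Moving n

  module _ (A : Subset n) where

    private
      P : Pred (Fin n) 0ℓ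
      P = _∈ A

    Reachable : ℤ → Fin n → Set
    Reachable z c = ∃[ y ] c ≡ ⌊ y ⌋ × z ≤ y × Segment P z (y + 1ℤ)

    interval-in : ∀ k z → ⌊ z ⌋ ∈ A → intervalWord A (suc k) ⌊ z ⌋ ≡ intervalWord A k ⌊ z + 1ℤ ⌋ ∷ʳ ⌊ z ⌋
    interval-in k z z∈ = trans
      (cong (λ b → if b then intervalWord A k (next ⌊ z ⌋) ∷ʳ ⌊ z ⌋ else []) (dec-true (⌊ z ⌋ ∈? A) z∈))
      (cong (λ i → intervalWord A k i ∷ʳ ⌊ z ⌋) (next-⌊⌋ z))

    interval-out : ∀ k z → ⌊ z ⌋ ∉ A → intervalWord A (suc k) ⌊ z ⌋ ≡ []
    interval-out k z z∉ =
      cong (λ b → if b then intervalWord A k (next ⌊ z ⌋) ∷ʳ ⌊ z ⌋ else []) (dec-false (⌊ z ⌋ ∈? A) z∉)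

    interval-sound : ∀ k z {c} → c ∈ˡ intervalWord A k ⌊ z ⌋ → Reachable z c
    interval-sound (suc k) z {c} c∈ = step (⌊ z ⌋ ∈? A)
      where
      last : ⌊ z ⌋ ∈ A → c ∈ˡ intervalWord A k ⌊ z + 1ℤ ⌋ ⊎ c ∈ˡ ⌊ z ⌋ ∷ [] → Reachable z c
      last z∈ (inj₁ c∈′) with y , e , z+1≤y , seg ← interval-sound k (z + 1ℤ) c∈′ =
        y , e , ℤ.≤-trans (ℤ.<⇒≤ (x<x+1 z)) z+1≤y , segment-cons P z∈ seg
      last z∈ (inj₂ (here e)) = z , e , ℤ.≤-refl , segment-snoc P (segment-empty P z) z∈
      step : Dec (⌊ z ⌋ ∈ A) → Reachable z c
      step (yes z∈) = last z∈ (List.∈-++⁻ (intervalWord A k ⌊ z + 1ℤ ⌋) (subst (c ∈ˡ_) (interval-in k z z∈) c∈))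
      step (no z∉)  = contradiction (subst (c ∈ˡ_) (interval-out k z z∉) c∈) λ ()

    interval-complete : ∀ k z d → d ℕ.< k → Segment P z (z + + d + 1ℤ) →
                        ⌊ z + + d ⌋ ∈ˡ intervalWord A k ⌊ z ⌋
    interval-complete (suc k) z d d<k seg = subst (⌊ z + + d ⌋ ∈ˡ_) (sym (interval-in k z z∈)) (step d d<k seg)
      where
      lem : ∀ z d → z + 1ℤ + d ≡ z + (1ℤ + d)
      lem = solve-∀
      lem′ : ∀ z d → z + 1ℤ + d + 1ℤ ≡ z + (1ℤ + d) + 1ℤ
      lem′ = solve-∀
      z∈ : ⌊ z ⌋ ∈ A
      z∈ = seg ℤ.≤-refl (ℤ.≤-<-trans (ℤ.i≤i+j z (+ d)) (x<x+1 _))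
      step : ∀ d → d ℕ.< suc k → Segment P z (z + + d + 1ℤ) → ⌊ z + + d ⌋ ∈ˡ intervalWord A k ⌊ z + 1ℤ ⌋ ∷ʳ ⌊ z ⌋
      step zero _ _ = List.∈-++⁺ʳ (intervalWord A k ⌊ z + 1ℤ ⌋) (here (cong ⌊_⌋ (ℤ.+-identityʳ z)))
      step (suc d) (ℕ.s≤s d<k) seg =
        List.∈-++⁺ˡ (subst (λ x → ⌊ x ⌋ ∈ˡ intervalWord A k ⌊ z + 1ℤ ⌋) (lem z (+ d))
          (interval-complete k (z + 1ℤ) d d<k
            λ a b → seg (ℤ.≤-trans (ℤ.<⇒≤ (x<x+1 z)) a) (subst (_ <_) (lem′ z (+ d)) b)))

    -- The recursion moves `z` up, but the start `x` of the interval is remembered: incongruence of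
    -- the letters is a property of the whole block over the gap x - 1.
    interval-decreasing : ∀ k x z → x ≤ z → Block P x z → AllPairs _▹_ (intervalWord A k ⌊ z ⌋)
    interval-decreasing zero    x z x≤z B = []
    interval-decreasing (suc k) x z x≤z B = step (⌊ z ⌋ ∈? A)
      where
      step : Dec (⌊ z ⌋ ∈ A) → AllPairs _▹_ (intervalWord A (suc k) ⌊ z ⌋)
      step (no z∉)  = subst (AllPairs _▹_) (sym (interval-out k z z∉)) []
      step (yes z∈) = subst (AllPairs _▹_) (sym (interval-in k z z∈))
        (AllPairs.++⁺ (interval-decreasing k x (z + 1ℤ) (ℤ.≤-trans x≤z (ℤ.<⇒≤ (x<x+1 z))) B′) ([] ∷ [])
          (All.tabulate λ c∈ → later (interval-sound k (z + 1ℤ) c∈) ∷ []))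
       where
        B′ : Block P x (z + 1ℤ)
        B′ = block (start B) (segment-snoc P (segment B) z∈)
        later : ∀ {c} → Reachable (z + 1ℤ) c → c ▹ ⌊ z ⌋
        later (y , refl , z<y , seg) =
          (λ e → block-≢ₙ B″ (ℤ.≤-trans (ℤ.<⇒≤ (x-1<x x)) x≤z) (+1≤⇒< z<y) (x<x+1 y) (⌊⌋-injective e)) ,
          -- z ≡ y + 1 would make z - 1 and y congruent; for z = x this compares y with the gap x -
          -- 1.
          (λ e → block-≢ₙ B″ (ℤ.+-monoˡ-≤ (- 1ℤ) x≤z)
            (ℤ.<-trans (x-1<x z) (+1≤⇒< z<y)) (x<x+1 y)
            (≡ₙ-cancel-+ 1ℤ (subst (_≡ₙ y + 1ℤ) (sym (-1+1 z)) (⌊⌋-injective (trans e (next-⌊⌋ y))))))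
          where
          B″ : Block P x (y + 1ℤ)
          B″ = block (start B) λ {t} x≤t t<y+1 → split (ℤ._<?_ t (z + 1ℤ)) x≤t t<y+1
            where
            split : ∀ {t} → Dec (t < z + 1ℤ) → x ≤ t → t < y + 1ℤ → P ⌊ t ⌋
            split (yes t<) x≤t _ = segment B′ x≤t t<
            split (no t≮)  _ t<y+1 = seg (ℤ.≮⇒≥ t≮) t<y+1

    private
      start? : ∀ i → Dec (i ∈ A × ¬ prev i ∈ A)
      start? i = i ∈? A ×-dec ¬? (prev i ∈? A)

    word : List (Fin n)
    word = List.concatMap (intervalWord A n) (starts A)

    ⌊⌋-elim : (Q : Fin n → Set) → (∀ x → Q ⌊ x ⌋) → ∀ c → Q c
    ⌊⌋-elim Q f c = subst Q (⌊⌋-toℕ c) (f (+ toℕ c))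

    start-∉ : ∀ x → ⌊ x ⌋ ∈ˡ starts A → ⌊ x - 1ℤ ⌋ ∉ A
    start-∉ x x∈ = proj₂ (proj₂ (List.∈-filter⁻ start? {xs = List.allFin n} x∈)) ∘ subst P (sym (prev-⌊⌋ x))

    InBlock : Fin n → Fin n → Set
    InBlock i c = ∃[ x ] ∃[ y ] i ≡ ⌊ x ⌋ × c ≡ ⌊ y ⌋ × x ≤ y × Block P x (y + 1ℤ)

    start-block : ∀ i → i ∈ˡ starts A → ∀ {c} → c ∈ˡ intervalWord A n i → InBlock i c
    start-block = ⌊⌋-elim (λ i → i ∈ˡ starts A → ∀ {c} → c ∈ˡ intervalWord A n i → InBlock i c)
      λ x s∈ c∈ → let y , e , x≤y , seg = interval-sound n x c∈ in
        x , y , refl , e , x≤y , block (start-∉ x s∈) seg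

    -- Equal letters would have equal starts by `block-start-unique`. If y′ ≡ y + 1, then y is
    -- congruent to y′ - 1, which is either the gap below the second block or a letter of it, and in
    -- the latter case the starts agree again.
    different-blocks : ∀ {x x′ y y′} → x ≤ y → x′ ≤ y′ → Block P x (y + 1ℤ) → Block P x′ (y′ + 1ℤ) →
                       ⌊ x ⌋ ≢ ⌊ x′ ⌋ → ⌊ y ⌋ ▹ ⌊ y′ ⌋
    different-blocks {x} {x′} {y} {y′} x≤y x′≤y′ B C x≢x′ =
      (λ e → x≢x′ (block-start-unique x≤y x′≤y′ B C (≡ₙ-sym (⌊⌋-injective e)))) ,
      (λ e → next≢ (⌊⌋-injective (trans e (next-⌊⌋ y)) , ≤-cases x′≤y′))
      where
      next≢ : ¬ (y′ ≡ₙ y + 1ℤ × (x′ ≡ y′ ⊎ x′ < y′))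
      next≢ (y′≡ , x′≤) = cases x′≤
        where
        y≡ : y ≡ₙ y′ - 1ℤ
        y≡ = ≡ₙ-cancel-+ 1ℤ (subst (y + 1ℤ ≡ₙ_) (sym (-1+1 y′)) (≡ₙ-sym y′≡))
        cases : ¬ (x′ ≡ y′ ⊎ x′ < y′)
        cases (inj₁ x′≡y′) = start C (subst (λ z → P ⌊ z - 1ℤ ⌋) (sym x′≡y′)
          (subst P (⌊⌋-cong y≡) (segment B x≤y (x<x+1 y))))
        cases (inj₂ x′<y′) = x≢x′ (block-start-unique x≤y (<⇒≤-1 x′<y′) B
              (block-shrink C (ℤ.≤-trans (ℤ.≤-reflexive (-1+1 y′)) (ℤ.<⇒≤ (x<x+1 y′)))) y≡)

    different-starts : ∀ {i j} → i ∈ˡ starts A → j ∈ˡ starts A → i ≢ j →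
      ∀ {c d} → c ∈ˡ intervalWord A n i → d ∈ˡ intervalWord A n j → c ▹ d
    different-starts {i} {j} i∈ j∈ i≢j {c} {d} c∈ d∈ = apart (start-block i i∈ c∈) (start-block j j∈ d∈)
      where
      apart : InBlock i c → InBlock j d → c ▹ d
      apart (x , y , i≡ , c≡ , x≤y , B) (x′ , y′ , j≡ , d≡ , x′≤y′ , C) =
        subst₂ _▹_ (sym c≡) (sym d≡) (different-blocks x≤y x′≤y′ B C λ e → i≢j (trans i≡ (trans e (sym j≡))))

    word-decreasing : AllPairs _▹_ word
    word-decreasing = blocks (starts A) (λ i∈ → i∈)
        (AllPairs.filter⁺ start? (Unique.allFin⁺ n))
      where
      blocks : ∀ is → (∀ {i} → i ∈ˡ is → i ∈ˡ starts A) → AllPairs _≢_ is →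
               AllPairs _▹_ (List.concatMap (intervalWord A n) is)
      blocks []       _ _          = []
      blocks (i ∷ is) f (i≢ ∷ is≢) = AllPairs.++⁺ (first (f (here refl))) (blocks is (f ∘ there) is≢)
        (All.tabulate λ c∈ → All.tabulate λ d∈ →
          cross c∈ (find (List.∈-concatMap⁻ (intervalWord A n) {xs = is} d∈)))
        where
        first : i ∈ˡ starts A → AllPairs _▹_ (intervalWord A n i)
        first = ⌊⌋-elim (λ i → i ∈ˡ starts A → AllPairs _▹_ (intervalWord A n i)) (λ x x∈ →
          interval-decreasing n x x ℤ.≤-refl (block (start-∉ x x∈) (segment-empty P x))) i
        cross : ∀ {c d} → c ∈ˡ intervalWord A n i →
                ∃[ j ] j ∈ˡ is × d ∈ˡ intervalWord A n j → c ▹ d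
        cross c∈ (j , j∈ , d∈) =
          different-starts (f (here refl)) (f (there j∈)) (All.lookup i≢ j∈) c∈ d∈

    word-sound : ∀ {c} → c ∈ˡ word → c ∈ A
    word-sound {c} c∈ = in-A (find (List.∈-concatMap⁻ (intervalWord A n) {xs = starts A} c∈))
      where
      in-A : ∃[ i ] i ∈ˡ starts A × c ∈ˡ intervalWord A n i → c ∈ A
      in-A (i , i∈ , c∈) = let x , y , _ , c≡ , x≤y , B = start-block i i∈ c∈ in
        subst P (sym c≡) (segment B x≤y (x<x+1 y))

    word-complete : A ⊂ ⊤ → ∀ {c} → c ∈ A → c ∈ˡ word
    word-complete A⊂ {c} = ⌊⌋-elim (λ c → c ∈ A → c ∈ˡ word)
        (λ y y∈ → let x , x≤y , B = block-below A⊂ y∈ in in-word x≤y B (≤⇒+ℕ x≤y)) c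
      where
      lem : ∀ x n → x - 1ℤ + n ≡ x + n - 1ℤ
      lem = solve-∀
      in-word : ∀ {x y} → x ≤ y → Block P x (y + 1ℤ) → ∃[ d ] y ≡ x + + d → ⌊ y ⌋ ∈ˡ word
      in-word {x} x≤y B (d , refl) =
        List.∈-concatMap⁺ (intervalWord A n) (lose x∈ (interval-complete n x d d<n (segment B)))
        where
        x∈ : ⌊ x ⌋ ∈ˡ starts A
        x∈ = List.∈-filter⁺ start? (List.∈-allFin _)
          (segment B ℤ.≤-refl (ℤ.≤-<-trans x≤y (x<x+1 _)) , start B ∘ subst P (prev-⌊⌋ x))
        -- The recursion bound n of `intervalWord` is enough: for d ≥ n the block would contain x -
        -- 1 + n, a copy of the gap.
        d<n : d ℕ.< n
        d<n = ℕ.≰⇒> λ n≤d → block-≢ₙ B ℤ.≤-refl (x<x+n (x - 1ℤ))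
          (ℤ.≤-<-trans (ℤ.≤-trans (ℤ.≤-reflexive (lem x (+ n))) (ℤ.≤-trans (ℤ.<⇒≤ (x-1<x _)) (ℤ.+-monoʳ-≤ x (+≤+ n≤d)))) (x<x+1 _))
          (≡ₙ-sym (x+n≡ₙx (x - 1ℤ)))

    -- All later knowledge of how `w⟨ A ⟩` acts is drawn from this description.
    w-moves : A ⊂ ⊤ → ∀ x → Moves P x (apply w⟨ A ⟩ x)
    w-moves A⊂ x = moves-ext word-sound (word-complete A⊂) (decreasing-moves word-decreasing x)

    word-length : A ⊂ ⊤ → List.length word ≡ card A
    word-length A⊂ = list-size word A (AllPairs.map (λ p e → proj₁ p (sym e)) word-decreasing) word-sound (word-complete A⊂)

-- Inversions of cyclically decreasing elements and deletion of a letter.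

module Inversions (n : ℕ) .{{_ : NonTrivial n}} where
  open AffineSymmetric n
  open S̃ using (apply; perm; periodic)
  open Residues n
  open Moving n
  open Words n

  apply-injective : ∀ w {x y} → apply w x ≡ apply w y → x ≡ y
  apply-injective w {x} {y} e = trans (sym (Inverse.strictlyInverseʳ (perm w) x))
    (trans (cong (Inverse.from (perm w)) e) (Inverse.strictlyInverseʳ (perm w) y))

  apply-≡ₙ : ∀ w {x y} → x ≡ₙ y → apply w x ≡ₙ apply w y
  apply-≡ₙ w = map-≡ₙ (apply w) (periodic w)

  apply-≡ₙ⁻ : ∀ w {x y} → apply w x ≡ₙ apply w y → x ≡ₙ y
  apply-≡ₙ⁻ w {x} {y} e = subst₂ _≡ₙ_ (Inverse.strictlyInverseʳ (perm w) x) (Inverse.strictlyInverseʳ (perm w) y)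
    (map-≡ₙ (Inverse.from (perm w)) (from-periodic (perm w) (periodic w)) e)

  apply-+ : ∀ w {x k} → x + k ≡ₙ x → apply w (x + k) ≡ apply w x + k
  apply-+ w {x} {k} k≡ = begin
    apply w (x + k)                        ≡⟨ lem (apply w (x + k)) (x + k) ⟩
    (apply w (x + k) - (x + k)) + (x + k)  ≡⟨ cong (λ z → z + (x + k)) (shift-≡ₙ (apply w) (periodic w) k≡) ⟩
    (apply w x - x) + (x + k)              ≡⟨ lem′ (apply w x) x k ⟩
    apply w x + k                          ∎
    where
    open ≡-Reasoning
    lem : ∀ a x → a ≡ (a - x) + x
    lem = solve-∀
    lem′ : ∀ a x k → (a - x) + (x + k) ≡ a + k
    lem′ = solve-∀

  +-difference : ∀ x y → x + (y - x) ≡ y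
  +-difference = solve-∀

  swap-first : ∀ {p q} k → p + k ≡ₙ p → swap p q (p + k) ≡ q + k
  swap-first {p} {q} k k≡ = trans (cong (λ z → p + k + z) (shift-r p q k≡)) (lem p q k)
    where
    lem : ∀ p q k → p + k + (q - p) ≡ q + k
    lem = solve-∀

  swap-second : ∀ {p q} k → p ≢ₙ q → q + k ≡ₙ q → swap p q (q + k) ≡ p + k
  swap-second {p} {q} k p≢q k≡ = trans (cong (λ z → q + k + z) (shift-s p q p≢q k≡)) (lem p q k)
    where
    lem : ∀ p q k → q + k + (p - q) ≡ p + k
    lem = solve-∀

  swap-other : ∀ {p q} z → z ≢ₙ p → z ≢ₙ q → swap p q z ≡ z
  swap-other {p} {q} z z≢p z≢q = trans (cong (λ d → z + d) (shift-other p q z≢p z≢q)) (ℤ.+-identityʳ z)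

  -- A view of an integer for computing `swap p q`. The congruence p + k ≡ p encodes that n divides
  -- k.
  data Position (p q : ℤ) : ℤ → Set where
    first  : ∀ k → p + k ≡ₙ p → Position p q (p + k)
    second : ∀ k → q + k ≡ₙ q → Position p q (q + k)
    other  : ∀ {z} → z ≢ₙ p → z ≢ₙ q → Position p q z

  position : ∀ p q z → Position p q z
  position p q z = decide (z ≡ₙ? p) (z ≡ₙ? q)
    where
    decide : Dec (z ≡ₙ p) → Dec (z ≡ₙ q) → Position p q z
    decide (yes z≡p) _ = subst (Position p q) (+-difference p z)
      (first (z - p) (subst (_≡ₙ p) (sym (+-difference p z)) z≡p))
    decide (no _) (yes z≡q) = subst (Position p q) (+-difference q z)
      (second (z - q) (subst (_≡ₙ q) (sym (+-difference q z)) z≡q))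
    decide (no z≢p) (no z≢q) = other z≢p z≢q

  ≡ₙ-period : ∀ {p k} q → p + k ≡ₙ p → q + k ≡ₙ q
  ≡ₙ-period {p} {k} q k≡ = subst₂ _≡ₙ_ (lem p q k) (+-difference p q) (≡ₙ-+ (q - p) k≡)
    where
    lem : ∀ p q k → p + k + (q - p) ≡ q + k
    lem = solve-∀

  -- Conjugation of a reflection by w, from w commuting with translation by multiples of n. It
  -- carries a reflection past the factors on its right, so that it can be written in terms of the
  -- wires' entry points.
  swap-conjugate : ∀ w {p q} → p ≢ₙ q → ∀ z →
    apply w (swap p q z) ≡ swap (apply w p) (apply w q) (apply w z)
  swap-conjugate w {p} {q} p≢q z = case (position p q z)
    where
    wp≢wq : apply w p ≢ₙ apply w q
    wp≢wq = p≢q ∘ apply-≡ₙ⁻ w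
    case : ∀ {z} → Position p q z → apply w (swap p q z) ≡ swap (apply w p) (apply w q) (apply w z)
    case (first k k≡) = trans (cong (apply w) (swap-first k k≡)) (trans (apply-+ w (≡ₙ-period q k≡))
      (sym (trans (cong (swap _ _) (apply-+ w k≡)) (swap-first {apply w p} {apply w q} k (≡ₙ-period _ k≡)))))
    case (second k k≡) = trans (cong (apply w) (swap-second k p≢q k≡)) (trans (apply-+ w (≡ₙ-period p k≡))
      (sym (trans (cong (swap _ _) (apply-+ w k≡)) (swap-second k wp≢wq (≡ₙ-period _ k≡)))))
    case {z} (other z≢p z≢q) = trans (cong (apply w) (swap-other z z≢p z≢q))
      (sym (swap-other _ (z≢p ∘ apply-≡ₙ⁻ w) (z≢q ∘ apply-≡ₙ⁻ w)))

  record Inverted (w : S̃) (x y : ℤ) : Set where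
    constructor inverted
    field
      ordered  : x < y
      reversed : apply w y < apply w x

  open Inverted public

  inverted? : ∀ w x y → Dec (Inverted w x y)
  inverted? w x y = map′ (λ (p , q) → inverted p q) (λ (inverted p q) → p , q)
    (x ℤ.<? y ×-dec apply w y ℤ.<? apply w x)

  inverted-shift : ∀ w {x y} k → x + k ≡ₙ x → Inverted w x y → Inverted w (x + k) (y + k)
  inverted-shift w {x} {y} k k≡ (inverted p q) = inverted (ℤ.+-monoˡ-< k p)
    (subst₂ _<_ (sym (apply-+ w (≡ₙ-period y k≡))) (sym (apply-+ w k≡)) (ℤ.+-monoˡ-< k q))

  inverted-≢ₙ : ∀ w {x y} → Inverted w x y → x ≢ₙ y
  inverted-≢ₙ w {x} {y} (inverted p q) x≡y = ℤ.<-asym q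
    (subst₂ _<_ (lem (apply w x) x) (trans (lem′ (apply w x) x y) (sym wy)) (ℤ.+-monoʳ-< (apply w x - x) p))
    where
    lem : ∀ a x → a - x + x ≡ a
    lem = solve-∀
    lem′ : ∀ a x y → a - x + y ≡ a + (y - x)
    lem′ = solve-∀
    e : x + (y - x) ≡ y
    e = +-difference x y
    wy : apply w y ≡ apply w x + (y - x)
    wy = trans (cong (apply w) (sym e)) (apply-+ w (subst (_≡ₙ x) (sym e) (≡ₙ-sym x≡y)))

  record Arc (A : Subset n) (x y : ℤ) : Set where
    constructor arc
    field
      x<y   : x < y
      within : Block (_∈ A) x y

    top∈ : ⌊ y - 1ℤ ⌋ ∈ A
    top∈ = segment within (<⇒≤-1 x<y) (x-1<x y)

  open Arc public

  arc-shift : ∀ {A x y} k → x + k ≡ₙ x → Arc A x y → Arc A (x + k) (y + k)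
  arc-shift k k≡ (arc x<y B) = arc (ℤ.+-monoˡ-< k x<y) (block-shift k k≡ B)

  module _ {A : Subset n} (A⊂ : A ⊂ ⊤) where

    -- y descends to y - 1, while the climb from x cannot stop before y.
    arc⇒inverted : ∀ {x y} → Arc A x y → Inverted w⟨ A ⟩ x y
    arc⇒inverted {x} {y} a@(arc x<y B) = inverted x<y
      (compare (w-moves A A⊂ x) (w-moves A A⊂ y))
      where
      compare : ∀ {u v} → Moves (_∈ A) x u → Moves (_∈ A) y v → v < u
      compare (down p) _ = contradiction p (start B)
      compare (up _ _ u∉) (up _ C _) = contradiction (top∈ a) (start C)
      compare (up x≤u _ u∉) (down _) = ≤⇒-1< (ℤ.≮⇒≥ λ u<y → u∉ (segment B x≤u u<y))

    -- Order is reversed only if x climbs to y or beyond and y descends: two descents keep the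
    -- order, and if y climbs as well then y - 1 is a gap that stops the climb from x.
    inverted⇒arc : ∀ {x y} → Inverted w⟨ A ⟩ x y → Arc A x y
    inverted⇒arc {x} {y} (inverted x<y wy<wx) =
      arc x<y (compare (w-moves A A⊂ x) (w-moves A A⊂ y) wy<wx)
      where
      compare : ∀ {u v} → Moves (_∈ A) x u → Moves (_∈ A) y v → v < u → Block (_∈ A) x y
      compare (down _) (down _) v<u = contradiction v<u (ℤ.<-asym (-1-mono-< x<y))
      compare (down _) (up y≤v _ _) v<u =
        contradiction (ℤ.<-trans x<y (ℤ.≤-<-trans y≤v v<u)) (ℤ.<-asym (x-1<x x))
      compare (up x≤u B u∉) (down _) v<u = block-shrink B (-1<⇒≤ v<u)
      compare (up x≤u B u∉) (up y≤v C _) v<u =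
        contradiction (segment B (<⇒≤-1 x<y) (ℤ.<-trans (x-1<x y) (ℤ.≤-<-trans y≤v v<u))) (start C)

  ∖-proper : ∀ {A : Subset n} {c} → A ⊂ ⊤ → A ∖ c ⊂ ⊤
  ∖-proper {A} (_ , d , d∈ , d∉) = (λ _ → Subset.∈⊤) , d , d∈ , d∉ ∘ proj₁ ∘ ∈-∖⁻ A

  module _ {A : Subset n} where

    private
      ∈∖ : ∀ {c d} → d ∈ A → d ≢ c → d ∈ A ∖ c
      ∈∖ = Subset.x∈p∧x≢y⇒x∈p-y

    -- Without the letter y - 1, the climb from x stops at y - 1, where y used to go, and y can no
    -- longer descend and climbs to where x used to go. The two wires exchange their targets and all
    -- incongruent ones keep theirs.
    delete-moves-first : ∀ {x y t} → Arc A x y → Moves (_∈ A) y t → Moves (_∈ A ∖ ⌊ y - 1ℤ ⌋) x t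
    delete-moves-first a (up _ C _) = contradiction (top∈ a) (start C)
    delete-moves-first {x} {y} a@(arc x<y B) (down _) = up (<⇒≤-1 x<y)
      (block (start B ∘ proj₁ ∘ ∈-∖⁻ A) λ {z} x≤z z<y-1 →
        ∈∖ (segment B x≤z (ℤ.<-trans z<y-1 (x-1<x y)))
           λ e → block-≢ₙ B (ℤ.≤-trans (ℤ.<⇒≤ (x-1<x x)) x≤z) z<y-1 (x-1<x y) (⌊⌋-injective e))
      λ y-1∈ → proj₂ (∈-∖⁻ A y-1∈) refl

    delete-moves-second : ∀ {x y t} → Arc A x y → Moves (_∈ A) x t → Moves (_∈ A ∖ ⌊ y - 1ℤ ⌋) y t
    delete-moves-second a (down p) = contradiction p (start (within a))
    delete-moves-second {x} {y} a@(arc x<y B) (up x≤t C t∉) = up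
      (ℤ.≮⇒≥ λ t<y → t∉ (segment B x≤t t<y))
      (block (λ y-1∈ → proj₂ (∈-∖⁻ A y-1∈) refl) λ {z} y≤z z<t →
        ∈∖ (segment C (ℤ.≤-trans (ℤ.<⇒≤ x<y) y≤z) z<t)
           λ e → block-≢ₙ C (ℤ.<⇒≤ (-1-mono-< x<y)) (≤⇒-1< y≤z) z<t (≡ₙ-sym (⌊⌋-injective e)))
      (t∉ ∘ proj₁ ∘ ∈-∖⁻ A)

    delete-moves-other : ∀ {x y z t} → Arc A x y → z ≢ₙ x → z ≢ₙ y →
      Moves (_∈ A) z t → Moves (_∈ A ∖ ⌊ y - 1ℤ ⌋) z t
    delete-moves-other {z = z} a z≢x z≢y (down z-1∈) = down (∈∖ z-1∈
      (z≢y ∘ ≡ₙ-cancel-+ (- 1ℤ) ∘ ⌊⌋-injective))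
    delete-moves-other {x} {y} {z} {t} a z≢x z≢y (up z≤t C t∉) = up z≤t
      (block (start C ∘ proj₁ ∘ ∈-∖⁻ A) λ z≤b b<t → ∈∖ (segment C z≤b b<t) λ e → meets z≤b b<t (⌊⌋-injective e))
      (t∉ ∘ proj₁ ∘ ∈-∖⁻ A)
      where
      -- If the climb from z used a letter congruent to y - 1, the arc could be translated to have b
      -- as its top letter. Two blocks through b have the same start, which would make z congruent
      -- to x.
      meets : ∀ {b} → z ≤ b → b < t → b ≢ₙ y - 1ℤ
      meets {b} z≤b b<t b≡ = compare (ℤ.<-cmp z x′)
        where
        e = b - (y - 1ℤ)
        x′ = x + e
        y′ = y + e
        e≡ : x + e ≡ₙ x
        e≡ = ≡ₙ-period x (subst (_≡ₙ y - 1ℤ) (sym (+-difference (y - 1ℤ) b)) b≡)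
        a′ : Arc A x′ y′
        a′ = arc-shift e e≡ a
        lem : ∀ y b → y + (b - (y - 1ℤ)) ≡ b + 1ℤ
        lem = solve-∀
        x′≤b : x′ ≤ b
        x′≤b = <+1⇒≤ (subst (x′ <_) (lem y b) (x<y a′))
        b<y′ : b < y′
        b<y′ = subst (b <_) (sym (lem y b)) (x<x+1 b)
        compare : ¬ _
        compare (tri< z<x′ _ _) = start (within a′) (segment C (<⇒≤-1 z<x′) (ℤ.<-trans (≤⇒-1< x′≤b) b<t))
        compare (tri≈ _ z≡x′ _) = z≢x (≡ₙ-trans (≡ₙ-reflexive z≡x′) e≡)
        compare (tri> _ _ x′<z) = start C (segment (within a′) (<⇒≤-1 x′<z) (ℤ.<-trans (≤⇒-1< z≤b) b<y′))

    delete-arc : A ⊂ ⊤ → ∀ {x y} → Arc A x y → ∀ z →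
      apply w⟨ A ∖ ⌊ y - 1ℤ ⌋ ⟩ z ≡ apply w⟨ A ⟩ (swap x y z)
    delete-arc A⊂ {x} {y} a z = moves-functional (w-moves _ (∖-proper A⊂) z) (case (position x y z))
      where
      x≢y : x ≢ₙ y
      x≢y = inverted-≢ₙ w⟨ A ⟩ (arc⇒inverted A⊂ a)
      top : ∀ k → x + k ≡ₙ x → ⌊ y + k - 1ℤ ⌋ ≡ ⌊ y - 1ℤ ⌋
      top k k≡ = ⌊⌋-cong (≡ₙ-+ (- 1ℤ) (≡ₙ-period y k≡))
      case : ∀ {z} → Position x y z → Moves (_∈ A ∖ ⌊ y - 1ℤ ⌋) z (apply w⟨ A ⟩ (swap x y z))
      case (first k k≡) = subst₂ (λ c t → Moves (_∈ A ∖ c) (x + k) t) (top k k≡)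
        (cong (apply w⟨ A ⟩) (sym (swap-first k k≡)))
        (delete-moves-first (arc-shift k k≡ a) (w-moves A A⊂ (y + k)))
      case (second k k≡) = subst₂ (λ c t → Moves (_∈ A ∖ c) (y + k) t) (top k (≡ₙ-period x k≡))
        (cong (apply w⟨ A ⟩) (sym (swap-second k x≢y k≡)))
        (delete-moves-second (arc-shift k (≡ₙ-period x k≡) a) (w-moves A A⊂ (x + k)))
      case {z} (other z≢x z≢y) = subst (Moves (_∈ A ∖ ⌊ y - 1ℤ ⌋) z)
        (cong (apply w⟨ A ⟩) (sym (swap-other z z≢x z≢y)))
        (delete-moves-other a z≢x z≢y (w-moves A A⊂ z))

    -- `A` can be read off from the action: x lies in it exactly when x + 1 descends.
    w-injective : A ⊂ ⊤ → ∀ {B} → B ⊂ ⊤ → w⟨ A ⟩ ≈ w⟨ B ⟩ → A ≡ B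
    w-injective A⊂ {B} B⊂ A≈B = Subset.⊆-antisym (λ {c} → ⌊⌋-elim A (λ c → c ∈ A → c ∈ B) (sub A B A⊂ B⊂ A≈B) c)
      (λ {c} → ⌊⌋-elim A (λ c → c ∈ B → c ∈ A) (sub B A B⊂ A⊂ (sym ∘ A≈B)) c)
      where
      sub : ∀ A B → A ⊂ ⊤ → B ⊂ ⊤ → w⟨ A ⟩ ≈ w⟨ B ⟩ → ∀ x → ⌊ x ⌋ ∈ A → ⌊ x ⌋ ∈ B
      sub A B A⊂ B⊂ A≈B x x∈ = subst (λ z → ⌊ z ⌋ ∈ B) (+1-1 x)
        (descends (w-moves A A⊂ (x + 1ℤ)) (w-moves B B⊂ (x + 1ℤ)) (A≈B (x + 1ℤ)))
        where
        descends : ∀ {u v} → Moves (_∈ A) (x + 1ℤ) u → Moves (_∈ B) (x + 1ℤ) v → u ≡ v → ⌊ x + 1ℤ - 1ℤ ⌋ ∈ B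
        descends _ (down p) _ = p
        descends (up _ C _) _ _ = contradiction (subst (λ z → ⌊ z ⌋ ∈ A) (sym (+1-1 x)) x∈) (start C)
        descends (down _) (up x+1≤v _ _) refl =
          contradiction (ℤ.≤-<-trans x+1≤v (x-1<x (x + 1ℤ))) (ℤ.<-irrefl refl)

-- The replacement L and its inverse.

module Bumping (n : ℕ) .{{_ : NonTrivial n}} where
  open AffineSymmetric n
  open Residues n
  open Moving n
  open Words n
  open Inversions n

  -- `d` is the distance down to the gap. With no step left, `firstGap` returns its argument, which
  -- at distance 0 is the gap already.
  firstGap-block : ∀ A x k d → d ℕ.≤ k → Block (_∈ A) x (x - 1ℤ + + d + 1ℤ) →
    firstGap A k ⌊ x - 1ℤ + + d ⌋ ≡ ⌊ x - 1ℤ ⌋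
  firstGap-block A x zero zero _ B = cong ⌊_⌋ (ℤ.+-identityʳ (x - 1ℤ))
  firstGap-block A x (suc k) zero _ B = trans
    (cong (λ b → if b then firstGap A k (prev i) else i) (dec-false (i ∈? A) (start B ∘ subst (_∈ A) i≡)))
    i≡
    where
    i = ⌊ x - 1ℤ + + 0 ⌋
    i≡ : i ≡ ⌊ x - 1ℤ ⌋
    i≡ = cong ⌊_⌋ (ℤ.+-identityʳ (x - 1ℤ))
  firstGap-block A x (suc k) (suc d) (ℕ.s≤s d≤k) B = trans
    (cong (λ b → if b then firstGap A k (prev i) else i) (dec-true (i ∈? A) i∈))
    (trans (cong (firstGap A k) (trans (prev-⌊⌋ z) (cong ⌊_⌋ (lem x (+ d)))))
      (firstGap-block A x k d d≤k (block-shrink B (ℤ.≤-trans (ℤ.≤-reflexive (lem″ x (+ d))) (ℤ.<⇒≤ (x<x+1 z))))))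
    where
    z = x - 1ℤ + + suc d
    i = ⌊ z ⌋
    lem : ∀ x d → x - 1ℤ + (1ℤ + d) - 1ℤ ≡ x - 1ℤ + d
    lem = solve-∀
    lem′ : ∀ x d → x + d ≡ x - 1ℤ + (1ℤ + d)
    lem′ = solve-∀
    lem″ : ∀ x d → x - 1ℤ + d + 1ℤ ≡ x - 1ℤ + (1ℤ + d)
    lem″ = solve-∀
    i∈ : i ∈ A
    i∈ = segment B (ℤ.≤-trans (ℤ.i≤i+j x (+ d)) (ℤ.≤-reflexive (lem′ x (+ d)))) (x<x+1 z)

  firstGap-arc : ∀ {A x y} → Arc A x y → firstGap A n ⌊ y - 1ℤ ⌋ ≡ ⌊ x - 1ℤ ⌋
  firstGap-arc {A} {x} {y} (arc x<y B) = from-distance (≤⇒+ℕ (ℤ.<⇒≤ (-1-mono-< x<y)))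
    where
    from-distance : ∃[ d ] y - 1ℤ ≡ x - 1ℤ + + d → firstGap A n ⌊ y - 1ℤ ⌋ ≡ ⌊ x - 1ℤ ⌋
    from-distance (d , y-1≡) = trans (cong (firstGap A n ∘ ⌊_⌋) y-1≡)
      (firstGap-block A x n d d≤n (subst (Block (_∈ A) x) (trans (sym (-1+1 y)) (cong (_+ 1ℤ) y-1≡)) B))
      where
      d≤n : d ℕ.≤ n
      d≤n = ℕ.≮⇒≥ λ n<d → block-≢ₙ B ℤ.≤-refl (x<x+n (x - 1ℤ))
        (ℤ.<-trans (ℤ.<-≤-trans (ℤ.+-monoʳ-< (x - 1ℤ) (+<+ n<d)) (ℤ.≤-reflexive (sym y-1≡))) (x-1<x y))
        (≡ₙ-sym (x+n≡ₙx (x - 1ℤ)))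

  module _ {A : Subset n} {x y : ℤ} (a : Arc A x y) where

    private
      C : Subset n
      C = A ∖ ⌊ y - 1ℤ ⌋

      gap∉C : ⌊ x - 1ℤ ⌋ ∉ C
      gap∉C = start (within a) ∘ proj₁ ∘ ∈-∖⁻ A

    L-arc : L A ⌊ y - 1ℤ ⌋ ≡ C ∪ ⁅ ⌊ x - 1ℤ ⌋ ⁆
    L-arc = cong (λ i → C ∪ ⁅ i ⁆) (firstGap-arc a)

    L-∖ : L A ⌊ y - 1ℤ ⌋ ∖ ⌊ x - 1ℤ ⌋ ≡ C
    L-∖ = trans (cong (_∖ ⌊ x - 1ℤ ⌋) L-arc) (insert-∖ C gap∉C)

    L-size : card (L A ⌊ y - 1ℤ ⌋) ≡ card A
    L-size = trans (cong card L-arc) (trans (insert-size C gap∉C) (∖-size A (top∈ a)))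

    L-proper : L A ⌊ y - 1ℤ ⌋ ⊂ ⊤
    L-proper = (λ _ → Subset.∈⊤) , ⌊ y - 1ℤ ⌋ , Subset.∈⊤ , λ ∈L → cases (∈-∪⁅⁆⁻ C (subst (⌊ y - 1ℤ ⌋ ∈_) L-arc ∈L))
      where
      cases : ¬ (⌊ y - 1ℤ ⌋ ∈ C ⊎ ⌊ y - 1ℤ ⌋ ≡ ⌊ x - 1ℤ ⌋)
      cases (inj₁ ∈C) = proj₂ (∈-∖⁻ A ∈C) refl
      cases (inj₂ e)  = start (within a) (subst (_∈ A) e (top∈ a))

    -- The inserted letter x - 1 tops an arc that ends at x, so the wire at x turns from the lower
    -- into the upper one. Its new partner enters at the start of the interval that now contains x -
    -- 1.
    L-has-arc : ∃[ w ] Arc (L A ⌊ y - 1ℤ ⌋) w x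
    L-has-arc = to-arc (block-below L-proper gap∈L)
      where
      gap∈L : ⌊ x - 1ℤ ⌋ ∈ L A ⌊ y - 1ℤ ⌋
      gap∈L = subst (⌊ x - 1ℤ ⌋ ∈_) (sym L-arc) (Subset.x∈p∪q⁺ (inj₂ (Subset.x∈⁅x⁆ _)))
      to-arc : (∃[ w ] w ≤ x - 1ℤ × Block (_∈ L A ⌊ y - 1ℤ ⌋) w (x - 1ℤ + 1ℤ)) → ∃[ w ] Arc (L A ⌊ y - 1ℤ ⌋) w x
      to-arc (w , w≤ , B) = w , arc (≤-1⇒< w≤) (subst (Block _ w) (-1+1 x) B)

    -- y - 1 is the first gap of A ∖ ⌊ y - 1 ⌋ from x upwards.
    top-segment : Segment (_∈ C) x (y - 1ℤ)
    top-segment {z} x≤z z<y-1 = Subset.x∈p∧x≢y⇒x∈p-y (segment (within a) x≤z (ℤ.<-trans z<y-1 (x-1<x y)))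
      λ e → block-≢ₙ (within a) (ℤ.≤-trans (ℤ.<⇒≤ (x-1<x x)) x≤z) z<y-1 (x-1<x y) (⌊⌋-injective e)

  segment-≤ : ∀ {C : Subset n} {x y z} → Segment (_∈ C) x y → x ≤ z → ⌊ z ⌋ ∉ C → y ≤ z
  segment-≤ seg x≤z z∉ = ℤ.≮⇒≥ λ z<y → z∉ (seg x≤z z<y)

  -- Given x, dropping x - 1 from the result leaves `A` without its marked letter, and that letter
  -- is the first gap from x upwards.
  L-injective : ∀ {A A′ x y y′} → Arc A x y → Arc A′ x y′ → L A ⌊ y - 1ℤ ⌋ ≡ L A′ ⌊ y′ - 1ℤ ⌋ →
    ⌊ y - 1ℤ ⌋ ≡ ⌊ y′ - 1ℤ ⌋ × A ≡ A′
  L-injective {A} {A′} {x} {y} {y′} a a′ L≡ = tops ,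
    trans (sym (∖-insert A (top∈ a))) (trans (cong₂ (λ C c → C ∪ ⁅ c ⁆) C≡ tops) (∖-insert A′ (top∈ a′)))
    where
    C≡ : A ∖ ⌊ y - 1ℤ ⌋ ≡ A′ ∖ ⌊ y′ - 1ℤ ⌋
    C≡ = trans (sym (L-∖ a)) (trans (cong (_∖ ⌊ x - 1ℤ ⌋) L≡) (L-∖ a′))
    tops : ⌊ y - 1ℤ ⌋ ≡ ⌊ y′ - 1ℤ ⌋
    tops = cong ⌊_⌋ (ℤ.≤-antisym
      (segment-≤ (top-segment a) (<⇒≤-1 (x<y a′)) λ ∈C → proj₂ (∈-∖⁻ A′ (subst (_ ∈_) C≡ ∈C)) refl)
      (segment-≤ (top-segment a′) (<⇒≤-1 (x<y a)) λ ∈C → proj₂ (∈-∖⁻ A (subst (_ ∈_) (sym C≡) ∈C)) refl))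

  record Preimage (B : Subset n) (x : ℤ) : Set where
    field
      {A}    : Subset n
      {y}    : ℤ
      arc-A  : Arc A x y
      L≡     : L A ⌊ y - 1ℤ ⌋ ≡ B
      proper : A ⊂ ⊤

  -- The letter x - 1 is moved up to the first gap y from x upwards; this creates the arc from x to
  -- y + 1.
  L-surjective : ∀ {B x} → B ⊂ ⊤ → ⌊ x - 1ℤ ⌋ ∈ B → Preimage B x
  L-surjective {B} {x} B⊂ x-1∈ = from-gap (segment-above B⊂ x)
    where
    C : Subset n
    C = B ∖ ⌊ x - 1ℤ ⌋
    from-gap : (∃[ y ] x ≤ y × Segment (_∈ B) x y × ⌊ y ⌋ ∉ B) → Preimage B x
    from-gap (y , x≤y , seg , y∉) = record
      { arc-A = a ; L≡ = L≡B ; proper = (λ _ → Subset.∈⊤) , ⌊ x - 1ℤ ⌋ , Subset.∈⊤ , start (within a) }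
      where
      A′ : Subset n
      A′ = C ∪ ⁅ ⌊ y ⌋ ⁆
      y∉C : ⌊ y ⌋ ∉ C
      y∉C = y∉ ∘ proj₁ ∘ ∈-∖⁻ B
      lem : ∀ y n → y - n + n ≡ y
      lem = solve-∀
      lem′ : ∀ x n → x + n - 1ℤ ≡ x - 1ℤ + n
      lem′ = solve-∀
      lem″ : ∀ x n → x + n - n ≡ x
      lem″ = solve-∀
      -- Otherwise x - 1 + n ≤ z < y, so y - n is still in the segment from x and therefore in `B`,
      -- although y is not.
      z≢x-1 : ∀ {z} → x ≤ z → z < y → ⌊ z ⌋ ≢ ⌊ x - 1ℤ ⌋
      z≢x-1 {z} x≤z z<y e = y∉ (subst (_∈ B) (trans (sym (⌊⌋-+n (y - + n))) (cong ⌊_⌋ (lem y (+ n))))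
        (seg x≤y-n (subst (y - + n <_) (lem y (+ n)) (x<x+n (y - + n)))))
        where
        x+n≤y : x + + n ≤ y
        x+n≤y = -1<⇒≤ (ℤ.≤-<-trans (ℤ.≤-trans (ℤ.≤-reflexive (lem′ x (+ n)))
          (≡ₙ-gap (≡ₙ-sym (⌊⌋-injective e)) (≤⇒-1< x≤z))) z<y)
        x≤y-n : x ≤ y - + n
        x≤y-n = subst (_≤ y - + n) (lem″ x (+ n)) (ℤ.+-monoˡ-≤ (- + n) x+n≤y)
      x-1∉ : ⌊ x - 1ℤ ⌋ ∉ A′
      x-1∉ ∈A = cases (∈-∪⁅⁆⁻ C ∈A)
        where
        cases : ¬ (⌊ x - 1ℤ ⌋ ∈ C ⊎ ⌊ x - 1ℤ ⌋ ≡ ⌊ y ⌋)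
        cases (inj₁ ∈C) = proj₂ (∈-∖⁻ B ∈C) refl
        cases (inj₂ e)  = y∉ (subst (_∈ B) e x-1∈)
      a : Arc A′ x (y + 1ℤ)
      a = arc (ℤ.≤-<-trans x≤y (x<x+1 y)) (block x-1∉ (segment-snoc (_∈ A′)
        (λ x≤z z<y → Subset.x∈p∪q⁺ (inj₁ (Subset.x∈p∧x≢y⇒x∈p-y (seg x≤z z<y) (z≢x-1 x≤z z<y))))
        (Subset.x∈p∪q⁺ (inj₂ (Subset.x∈⁅x⁆ ⌊ y ⌋)))))
      L≡B : L A′ ⌊ y + 1ℤ - 1ℤ ⌋ ≡ B
      L≡B = trans (L-arc a) (trans (cong (_∪ ⁅ ⌊ x - 1ℤ ⌋ ⁆)
        (trans (cong (λ z → A′ ∖ ⌊ z ⌋) (+1-1 y)) (insert-∖ C y∉C))) (∖-insert B x-1∈))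

-- Wires of a tuple and their meetings.

module Crossings (n : ℕ) .{{_ : NonTrivial n}} where
  open AffineSymmetric n
  open S̃ using (apply)
  open Residues n
  open Inversions n

  Proper : ∀ {m} → Vec (Subset n) m → Set
  Proper = VecAll.All (_⊂ ⊤)

  proper-lookup : ∀ {m} {A : Vec (Subset n) m} → Proper A → ∀ i → lookup A i ⊂ ⊤
  proper-lookup (a⊂ VecAll.∷ _)  Fin.zero    = a⊂
  proper-lookup (_ VecAll.∷ A⊂) (Fin.suc i) = proper-lookup A⊂ i

  proper-update : ∀ {m} {A : Vec (Subset n) m} {f} → Proper A → ∀ i → f (lookup A i) ⊂ ⊤ → Proper (A [ i ]%= f)
  proper-update (_ VecAll.∷ A⊂)  Fin.zero    f⊂ = f⊂ VecAll.∷ A⊂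
  proper-update (a⊂ VecAll.∷ A⊂) (Fin.suc i) f⊂ = a⊂ VecAll.∷ proper-update A⊂ i f⊂

  π : ∀ {m} → Vec (Subset n) m → S̃
  π A = ∏ (Vec.map w⟨_⟩ A)

  -- The product of the factors to the right of the i-th one.
  after : ∀ {m} → Vec (Subset n) m → Fin m → S̃
  after (_ Vec.∷ A) Fin.zero    = π A
  after (_ Vec.∷ A) (Fin.suc i) = after A i

  after-update : ∀ {m} (A : Vec (Subset n) m) i {f} → after (A [ i ]%= f) i ≡ after A i
  after-update (_ Vec.∷ A) Fin.zero    = refl
  after-update (_ Vec.∷ A) (Fin.suc i) = after-update A i

  module _ {m : ℕ} (A : Vec (Subset n) m) (i : Fin m) where

    -- Wires are named by where they enter the whole diagram, hence the passage through `after A i`;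
    -- `p` is the lower wire on entering the factor.
    Crossing : ℤ → ℤ → Set
    Crossing p q = Inverted w⟨ lookup A i ⟩ (apply (after A i) p) (apply (after A i) q)

    Meeting : ℤ → ℤ → Set
    Meeting p q = Crossing p q ⊎ Crossing q p

    -- `q` is meant to be the upper wire: the letter of a crossing lies one below its position.
    letter : ℤ → Fin n
    letter q = ⌊ apply (after A i) q - 1ℤ ⌋

    delete : ℤ → Vec (Subset n) m
    delete q = A [ i ]%= (_∖ letter q)

    meeting? : ∀ p q → Dec (Meeting p q)
    meeting? p q = inverted? _ _ _ ⊎-dec inverted? _ _ _

    crossing-≢ₙ : ∀ {p q} → Crossing p q → p ≢ₙ q
    crossing-≢ₙ c = inverted-≢ₙ _ c ∘ apply-≡ₙ (after A i)

    crossing-∈ : ∀ {p q} → Proper A → Crossing p q → letter q ∈ lookup A i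
    crossing-∈ A⊂ c = top∈ (inverted⇒arc (proper-lookup A⊂ i) c)

    delete-proper : ∀ {q} → Proper A → Proper (delete q)
    delete-proper A⊂ = proper-update A⊂ i (∖-proper (proper-lookup A⊂ i))

  module _ {p q : ℤ} where

    delete-π : ∀ {m} (A : Vec (Subset n) m) i → Proper A → Crossing A i p q →
      ∀ z → apply (π (delete A i q)) z ≡ apply (π A) (swap p q z)
    delete-π (a Vec.∷ A) Fin.zero (a⊂ VecAll.∷ A⊂) c z =
      trans (delete-arc a⊂ (inverted⇒arc a⊂ c) (apply (π A) z))
            (cong (apply w⟨ a ⟩) (sym (swap-conjugate (π A) (crossing-≢ₙ (a Vec.∷ A) Fin.zero c) z)))
    delete-π (a Vec.∷ A) (Fin.suc i) (a⊂ VecAll.∷ A⊂) c z =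
      cong (apply w⟨ a ⟩) (delete-π A i A⊂ c z)

    swap-p : swap p q p ≡ q
    swap-p = trans (cong (λ z → p + z) (shift-r p q ≡ₙ-refl)) (+-difference p q)

    swap-q : p ≢ₙ q → swap p q q ≡ p
    swap-q p≢q = trans (cong (λ z → q + z) (shift-s p q p≢q ≡ₙ-refl)) (+-difference q p)

    private
      exchange : ∀ {w x y x′ y′} → x ≡ y′ → y ≡ x′ →
        Inverted w x y ⊎ Inverted w y x → Inverted w x′ y′ ⊎ Inverted w y′ x′
      exchange refl refl (inj₁ c) = inj₂ c
      exchange refl refl (inj₂ c) = inj₁ c

    -- Factors to the right of the deleted crossing see the wires unchanged. Factors to its left see
    -- p and q exchanged, which turns a meeting of the two into another meeting of the two.
    delete-meeting : ∀ {m} (A : Vec (Subset n) m) i → Proper A → Crossing A i p q → ∀ k → k ≢ i →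
      Meeting A k p q → Meeting (delete A i q) k p q
    delete-meeting A Fin.zero A⊂ c Fin.zero k≢i = contradiction refl k≢i
    delete-meeting (a Vec.∷ A) Fin.zero A⊂ c (Fin.suc k) _ mt = mt
    delete-meeting (a Vec.∷ A) (Fin.suc i) (_ VecAll.∷ A⊂) c Fin.zero _ = exchange
      (sym (trans (delete-π A i A⊂ c q) (cong (apply (π A)) (swap-q (crossing-≢ₙ A i c)))))
      (sym (trans (delete-π A i A⊂ c p) (cong (apply (π A)) swap-p)))
    delete-meeting (a Vec.∷ A) (Fin.suc i) (_ VecAll.∷ A⊂) c (Fin.suc k) k≢i =
      delete-meeting A i A⊂ c k (k≢i ∘ cong Fin.suc)

  apart-order : ∀ {w x y} → ¬ Inverted w x y → x < y → apply w x < apply w y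
  apart-order {w} {x} {y} apart x<y = ℤ.≤∧≢⇒<
    (ℤ.≮⇒≥ λ r → apart (inverted x<y r)) (λ e → ℤ.<-irrefl (apply-injective w e) x<y)

  unmet-order : ∀ {m} (A : Vec (Subset n) m) {p q} → (∀ k → ¬ Meeting A k p q) → p < q → apply (π A) p < apply (π A) q
  unmet-order Vec.[]      apart p<q = p<q
  unmet-order (a Vec.∷ A) apart p<q = apart-order {w⟨ a ⟩} (apart Fin.zero ∘ inj₁)
    (unmet-order A (apart ∘ Fin.suc) p<q)

  module _ {p q : ℤ} where

    -- To the right of their only meeting the wires keep the order in which they enter; `only-end`
    -- is the same argument on the left.
    only-start : ∀ {m} (A : Vec (Subset n) m) i → Crossing A i p q → (∀ k → Meeting A k p q → k ≡ i) → p < q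
    only-start (a Vec.∷ A) Fin.zero c only = compare (ℤ.<-cmp p q)
      where
      compare : Tri (p < q) (p ≡ q) (q < p) → p < q
      compare (tri< p<q _ _) = p<q
      compare (tri≈ _ p≡q _) = contradiction (≡ₙ-reflexive p≡q) (crossing-≢ₙ (a Vec.∷ A) Fin.zero c)
      compare (tri> _ _ q<p) = contradiction (ordered c)
        (ℤ.<-asym (unmet-order A (λ k mt → Fin.0≢1+n (sym (only (Fin.suc k) (Sum.swap mt)))) q<p))
    only-start (a Vec.∷ A) (Fin.suc i) c only =
      only-start A i c λ k mt → Fin.suc-injective (only (Fin.suc k) mt)

    only-end : ∀ {m} (A : Vec (Subset n) m) i → Crossing A i p q → (∀ k → Meeting A k p q → k ≡ i) →
      apply (π A) q < apply (π A) p
    only-end (a Vec.∷ A) Fin.zero c only = reversed c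
    only-end (a Vec.∷ A) (Fin.suc i) c only = apart-order {w⟨ a ⟩}
      (λ c′ → Fin.0≢1+n (only Fin.zero (inj₂ c′)))
      (only-end A i c λ k mt → Fin.suc-injective (only (Fin.suc k) mt))

    -- The two wires change sides at every meeting.
    opposite : ∀ {m} (A : Vec (Subset n) m) i j → i ≢ j → (∀ k → Meeting A k p q → k ≡ i ⊎ k ≡ j) →
      Crossing A i p q → ¬ Crossing A j p q
    opposite A Fin.zero Fin.zero i≢j _ _ _ = i≢j refl
    opposite (a Vec.∷ A) Fin.zero (Fin.suc j) i≢j only c d = ℤ.<-asym (ordered c)
      (only-end A j d λ k mt → Sum.[ (λ ()) , Fin.suc-injective ] (only (Fin.suc k) mt))
    opposite (a Vec.∷ A) (Fin.suc i) Fin.zero i≢j only c d = ℤ.<-asym (ordered d)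
      (only-end A i c λ k mt → Sum.[ Fin.suc-injective , (λ ()) ] (only (Fin.suc k) mt))
    opposite (a Vec.∷ A) (Fin.suc i) (Fin.suc j) i≢j only =
      opposite A i j (i≢j ∘ cong Fin.suc)
        λ k mt → Sum.map Fin.suc-injective Fin.suc-injective (only (Fin.suc k) mt)

-- Lengths by deletion of meetings.

module Lengths (n : ℕ) .{{_ : NonTrivial n}} where
  open AffineSymmetric n
  open S̃ using (apply)
  open Residues n
  open Moving n
  open Words n
  open Inversions n
  open Crossings n

  size : ∀ {m} → Vec (Subset n) m → ℕ
  size A = sum (Vec.map card A)

  size-delete : ∀ {m} (A : Vec (Subset n) m) i {c} → c ∈ lookup A i → size A ≡ suc (size (A [ i ]%= (_∖ c)))
  size-delete (a Vec.∷ A) Fin.zero    c∈ = cong (ℕ._+ size A) (sym (∖-size a c∈))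
  size-delete (a Vec.∷ A) (Fin.suc i) c∈ = trans (cong (card a ℕ.+_) (size-delete A i c∈)) (ℕ.+-suc (card a) _)

  singleton-proper : ∀ i → ⁅ i ⁆ ⊂ ⊤
  singleton-proper i = (λ _ → Subset.∈⊤) , next i , Subset.∈⊤ , λ e → next≢ (Subset.x∈⁅y⁆⇒x≡y i e)
    where
    next≢ : next i ≢ i
    next≢ e = x≢ₙx+1 (+ toℕ i) (⌊⌋-injective (trans (⌊⌋-toℕ i)
      (trans (sym e) (trans (cong next (sym (⌊⌋-toℕ i))) (next-⌊⌋ (+ toℕ i))))))

  singleton-≈ : ∀ i → w⟨ ⁅ i ⁆ ⟩ ≈ simple i
  singleton-≈ i x = moves-functional (w-moves ⁅ i ⁆ (singleton-proper i) x)
    (moves-ext (λ { (here refl) → Subset.x∈⁅x⁆ i }) (λ c∈ → here (Subset.x∈⁅y⁆⇒x≡y i c∈))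
      (decreasing-moves {i ∷ []} ([] ∷ []) x))

  -- Arbitrary words become tuples with one letter per factor, so that the results on meetings give
  -- lower bounds for lengths.
  singletons : (W : List (Fin n)) → Vec (Subset n) (List.length W)
  singletons W = Vec.map ⁅_⁆ (Vec.fromList W)

  singletons-proper : ∀ W → Proper (singletons W)
  singletons-proper []      = VecAll.[]
  singletons-proper (i ∷ W) = singleton-proper i VecAll.∷ singletons-proper W

  singletons-size : ∀ W → size (singletons W) ≡ List.length W
  singletons-size []      = refl
  singletons-size (i ∷ W) = cong₂ ℕ._+_ (Subset.∣⁅x⁆∣≡1 i) (singletons-size W)

  singletons-π : ∀ W → ⟦ W ⟧ ≈ π (singletons W)
  singletons-π []      z = refl
  singletons-π (i ∷ W) z = trans (cong (apply (simple i)) (singletons-π W z)) (sym (singleton-≈ i _))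

  ⟦++⟧ : ∀ V W z → apply ⟦ V ++ W ⟧ z ≡ apply ⟦ V ⟧ (apply ⟦ W ⟧ z)
  ⟦++⟧ []      W z = refl
  ⟦++⟧ (i ∷ V) W z = cong (apply (simple i)) (⟦++⟧ V W z)

  Represented : S̃ → ℕ → Set
  Represented w k = ∃[ W ] List.length W ≡ k × w ≈ ⟦ W ⟧

  represented-· : ∀ {u w k l} → Represented u k → Represented w l → Represented (u · w) (k ℕ.+ l)
  represented-· {u} (V , |V| , u≈V) (W , |W| , w≈W) =
    V ++ W , trans (List.length-++ V) (cong₂ ℕ._+_ |V| |W|) ,
    λ z → trans (cong (apply u) (w≈W z)) (trans (u≈V _) (sym (⟦++⟧ V W z)))

  w-word : ∀ {A} → A ⊂ ⊤ → Represented w⟨ A ⟩ (card A)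
  w-word {A} A⊂ = word A , word-length A A⊂ , λ _ → refl

  π-word : ∀ {m} {A : Vec (Subset n) m} → Proper A → Represented (π A) (size A)
  π-word VecAll.[] = [] , refl , λ _ → refl
  π-word {A = a Vec.∷ A} (a⊂ VecAll.∷ A⊂) = represented-· {w⟨ a ⟩} {π A} (w-word a⊂) (π-word A⊂)

  length-≤-size : ∀ {w k m} {A : Vec (Subset n) m} → HasLength w k → Proper A → w ≈ π A → k ℕ.≤ size A
  length-≤-size {k = k} H A⊂ w≈A = let W , |W| , A≈W = π-word A⊂ in
    subst (k ℕ.≤_) |W| (HasLength.minimal H W λ z → trans (w≈A z) (A≈W z))

  size⇒length : ∀ {w m} {A : Vec (Subset n) m} {k} → Proper A → w ≈ π A → size A ≡ k →
    (∀ W → w ≈ ⟦ W ⟧ → k ℕ.≤ List.length W) → HasLength w k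
  size⇒length A⊂ w≈A |A| min = let W , |W| , A≈W = π-word A⊂ in record
    { attained = W , trans |W| |A| , λ z → trans (w≈A z) (A≈W z) ; minimal = min }

  length-unique : ∀ {w w′ k l} → w ≈ w′ → HasLength w k → HasLength w′ l → k ≡ l
  length-unique w≈w′ H H′ = ℕ.≤-antisym (le w≈w′ H H′) (le (sym ∘ w≈w′) H′ H)
    where
    le : ∀ {w w′ k l} → w ≈ w′ → HasLength w k → HasLength w′ l → k ℕ.≤ l
    le {k = k} w≈w′ H H′ = let W , |W| , w′≈W = HasLength.attained H′ in
      subst (k ℕ.≤_) |W| (HasLength.minimal H W λ z → trans (w≈w′ z) (w′≈W z))

  swap-sym : ∀ {p q} → p ≢ₙ q → ∀ z → swap p q z ≡ swap q p z
  swap-sym {p} {q} p≢q z = case (position p q z)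
    where
    case : ∀ {z} → Position p q z → swap p q z ≡ swap q p z
    case (first k k≡)      = trans (swap-first k k≡) (sym (swap-second k (p≢q ∘ ≡ₙ-sym) k≡))
    case (second k k≡)     = trans (swap-second k p≢q k≡) (sym (swap-first k k≡))
    case (other {z} z≢p z≢q) = trans (swap-other z z≢p z≢q) (sym (swap-other z z≢q z≢p))

  Swapped : (p q : ℤ) → S̃ → S̃ → Set
  Swapped p q v w = ∀ z → apply v z ≡ apply w (swap p q z)

  meeting-≢ₙ : ∀ {m} (A : Vec (Subset n) m) i {p q} → Meeting A i p q → p ≢ₙ q
  meeting-≢ₙ A i (inj₁ c) = crossing-≢ₙ A i c
  meeting-≢ₙ A i (inj₂ c) = crossing-≢ₙ A i c ∘ ≡ₙ-sym

  record Deleted {m} (A : Vec (Subset n) m) (i : Fin m) (p q : ℤ) : Set where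
    field
      {B}     : Vec (Subset n) m
      proper  : Proper B
      smaller : size A ≡ suc (size B)
      swapped : Swapped p q (π B) (π A)
      others  : ∀ k → k ≢ i → Meeting A k p q → Meeting B k p q

  delete-meet : ∀ {m} {A : Vec (Subset n) m} i {p q} → Proper A → Meeting A i p q → Deleted A i p q
  delete-meet {A = A} i {p} {q} A⊂ (inj₁ c) = record
    { B       = delete A i q
    ; proper  = delete-proper A i A⊂
    ; smaller = size-delete A i (crossing-∈ A i A⊂ c)
    ; swapped = delete-π A i A⊂ c
    ; others  = delete-meeting A i A⊂ c }
  delete-meet {A = A} i {p} {q} A⊂ (inj₂ c) = record
    { B       = delete A i p
    ; proper  = delete-proper A i A⊂
    ; smaller = size-delete A i (crossing-∈ A i A⊂ c)
    ; swapped = λ z → trans (delete-π A i A⊂ c z) (cong (apply (π A)) (swap-sym (crossing-≢ₙ A i c) z))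
    ; others  = λ k k≢i → Sum.swap ∘ delete-meeting A i A⊂ c k k≢i ∘ Sum.swap }

  inversion⇒meeting : ∀ {m} (A : Vec (Subset n) m) {p q} → Inverted (π A) p q → ∃[ k ] Meeting A k p q
  inversion⇒meeting A {p} {q} c = decide (Fin.any? λ k → meeting? A k p q)
    where
    decide : Dec (∃[ k ] Meeting A k p q) → ∃[ k ] Meeting A k p q
    decide (yes found) = found
    decide (no none)   = contradiction (reversed c)
      (ℤ.<-asym (unmet-order A (λ k mt → none (k , mt)) (ordered c)))

  -- An exchange argument: in any word of `w` the wires p and q meet, and deleting a meeting leaves
  -- a word of `v` with one letter less.
  inversion-≤ : ∀ {v w p q k} → HasLength v k → Inverted w p q → Swapped p q v w →
    ∀ W → w ≈ ⟦ W ⟧ → k ℕ.< List.length W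
  inversion-≤ {v} {w} {p} {q} {k} H c v~w W w≈W = subst (k ℕ.<_) (singletons-size W)
    (bound (inversion⇒meeting A (inverted (ordered c) (subst₂ _<_ (w≈A q) (w≈A p) (reversed c)))))
    where
    A = singletons W
    w≈A : w ≈ π A
    w≈A z = trans (w≈W z) (singletons-π W z)
    bound : ∃[ i ] Meeting A i p q → k ℕ.< size A
    bound (i , mt) = subst (k ℕ.<_) (sym (Deleted.smaller D)) (ℕ.s≤s
      (length-≤-size {v} H (Deleted.proper D) λ z → trans (v~w z) (trans (w≈A (swap p q z)) (sym (Deleted.swapped D z)))))
      where D = delete-meet i (singletons-proper W) mt

  -- Induction on the number of letters: the arc under a letter is an inversion, so every word is
  -- longer than the length that is left after deleting this letter.
  w-length : ∀ {A} → A ⊂ ⊤ → HasLength w⟨ A ⟩ (card A)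
  w-length {A} A⊂ = go (card A) A⊂ refl
    where
    go : ∀ k {A} → A ⊂ ⊤ → card A ≡ k → HasLength w⟨ A ⟩ k
    go k {A} A⊂ |A| = record
      { attained = subst (Represented w⟨ A ⟩) |A| (w-word A⊂)
      ; minimal  = minimal k |A| }
      where
      minimal : ∀ k → card A ≡ k → ∀ W → w⟨ A ⟩ ≈ ⟦ W ⟧ → k ℕ.≤ List.length W
      minimal zero    _   _ _ = ℕ.z≤n
      minimal (suc k) |A| W A≈W = decide (Subset.nonempty? A)
        where
        decide : Dec (∃[ c ] c ∈ A) → suc k ℕ.≤ List.length W
        decide (no empty) = contradiction
          (trans (sym |A|) (trans (cong card (Subset.Empty-unique empty)) (Subset.∣⊥∣≡0 n))) λ ()
        decide (yes (c , c∈)) = ⌊⌋-elim A (λ c → c ∈ A → suc k ℕ.≤ List.length W)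
          (λ y y∈ → let x , x≤y , B = block-below A⊂ y∈ in
            from-arc (arc (ℤ.≤-<-trans x≤y (x<x+1 y)) B)) c c∈
          where
          from-arc : ∀ {x y} → Arc A x y → suc k ℕ.≤ List.length W
          from-arc {x} {y} a = inversion-≤ {w⟨ A ∖ ⌊ y - 1ℤ ⌋ ⟩} {w⟨ A ⟩}
            (go k (∖-proper {c = ⌊ y - 1ℤ ⌋} A⊂) (ℕ.suc-injective (trans (∖-size A (top∈ a)) |A|)))
            (arc⇒inverted A⊂ a) (delete-arc A⊂ a) W A≈W

-- Marked crossings whose removal gives v.

module Marks (n : ℕ) .{{_ : NonTrivial n}} {m : ℕ} (v : AffineSymmetric.S̃ n) (α : Vec ℕ m) {ℓv : ℕ}
             (length-v : AffineSymmetric.HasLength n v ℓv) (|α| : sum α ≡ suc ℓv) where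
  open AffineSymmetric n
  open S̃ using (apply; perm)
  open Little v α
  open Residues n
  open Moving n
  open Words n
  open Inversions n
  open Crossings n
  open Lengths n

  record Valid (A : Tuple) : Set where
    constructor valid
    field
      proper : Proper A
      sizes  : Vec.map card A ≡ α

  open Valid public

  valid-size : ∀ {A} → Valid A → size A ≡ suc ℓv
  valid-size V = trans (cong sum (sizes V)) |α|

  delete-letter-π : ∀ {k} (A : Vec (Subset n) k) i {p q c} → Proper A → Crossing A i p q → c ≡ letter A i q →
    ∀ z → apply (π (A [ i ]%= (_∖ c))) z ≡ apply (π A) (swap p q z)
  delete-letter-π A i A⊂ c refl = delete-π A i A⊂ c

  -- The wires p and q meet in the factor at the mark, with p the lower one on
  -- entering it, and the marked letter is the one at which they cross.
  record At (A : Tuple) (μ : Mark) (p q : ℤ) : Set where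
    constructor at
    field
      crosses : Crossing A (proj₁ μ) p q
      marked  : proj₂ μ ≡ letter A (proj₁ μ) q
      swaps   : Swapped p q v (π A)

  open At public

  module _ {A : Tuple} where

    at-≢ₙ : ∀ {μ p q} → At A μ p q → p ≢ₙ q
    at-≢ₙ {μ} a = crossing-≢ₙ A (proj₁ μ) (crosses a)

    crossing-asym : ∀ {i p q} → Crossing A i p q → ¬ Crossing A i q p
    crossing-asym c d = ℤ.<-asym (ordered c) (ordered d)

    at-unique : ∀ {i a b p q} → At A (i , a) p q → At A (i , b) p q ⊎ At A (i , b) q p → a ≡ b
    at-unique x (inj₁ y) = trans (marked x) (sym (marked y))
    at-unique x (inj₂ y) = contradiction (crosses y) (crossing-asym (crosses x))

    swapped-back : ∀ {p q} → p ≢ₙ q → Swapped p q v (π A) → Swapped p q (π A) v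
    swapped-back {p} {q} p≢q s z = trans (cong (apply (π A)) (sym (swap-involutive p q p≢q z))) (sym (s (swap p q z)))

    at-delete : ∀ {i a p q} → Proper A → At A (i , a) p q → v ≈ π (A [ i ]%= (_∖ a))
    at-delete {i} A⊂ (at c e s) z = trans (s z) (sym (delete-letter-π A i A⊂ c e z))

    at⇒removal : ∀ {μ p q} → Proper A → At A μ p q → Removal A μ
    at⇒removal {i , a} A⊂ x = subst (_∈ lookup A i) (sym (marked x)) (crossing-∈ A i A⊂ (crosses x)) ,
      at-delete A⊂ x

    -- The letter belongs to a crossing of some wires `lo` and `hi`. Its removal gives v as well, so
    -- `swap lo hi` and `swap p q` agree, and the pair is p, q in some order up to a common
    -- translation by a multiple of n.
    removal⇒at : ∀ {p q} → Proper A → p ≢ₙ q → Swapped p q v (π A) →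
      ∀ {j b} → Removal A (j , b) → At A (j , b) p q ⊎ At A (j , b) q p
    removal⇒at {p} {q} A⊂ p≢q s {j} {b} (b∈ , v≈) =
      ⌊⌋-elim (lookup A j) (λ b → b ∈ lookup A j → v ≈ π (A [ j ]%= (_∖ b)) → At A (j , b) p q ⊎ At A (j , b) q p)
        (λ y y∈ v≈ → let x , x≤y , B = block-below (proper-lookup A⊂ j) y∈ in
          from-arc y v≈ (arc (ℤ.≤-<-trans x≤y (x<x+1 y)) B)) b b∈ v≈
      where
      u : S̃
      u = after A j
      back : ℤ → ℤ
      back = Inverse.from (perm u)
      u-back : ∀ z → apply u (back z) ≡ z
      u-back = Inverse.strictlyInverseˡ (perm u)
      from-arc : ∀ {x} y → v ≈ π (A [ j ]%= (_∖ ⌊ y ⌋)) → Arc (lookup A j) x (y + 1ℤ) →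
                 At A (j , ⌊ y ⌋) p q ⊎ At A (j , ⌊ y ⌋) q p
      from-arc {x} y v≈ a = locate (position lo hi p) refl
        where
        lo hi : ℤ
        lo = back x
        hi = back (y + 1ℤ)
        c : Crossing A j lo hi
        c = subst₂ (Inverted w⟨ lookup A j ⟩) (sym (u-back x)) (sym (u-back (y + 1ℤ)))
          (arc⇒inverted (proper-lookup A⊂ j) a)
        y≡ : letter A j hi ≡ ⌊ y ⌋
        y≡ = cong ⌊_⌋ (trans (cong (_- 1ℤ) (u-back (y + 1ℤ))) (+1-1 y))
        same-swap : ∀ z → swap lo hi z ≡ swap p q z
        same-swap z = apply-injective (π A) (trans (sym (delete-letter-π A j A⊂ c (sym y≡) z)) (trans (sym (v≈ z)) (s z)))
        swap-p≡q : swap lo hi p ≡ q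
        swap-p≡q = trans (same-swap p) (swap-p {p} {q})
        shifted : ∀ k → lo + k ≡ₙ lo → Crossing A j (lo + k) (hi + k)
        shifted k k≡ = subst₂ (Inverted w⟨ lookup A j ⟩) (sym (apply-+ u k≡)) (sym (apply-+ u (≡ₙ-period hi k≡)))
          (inverted-shift w⟨ lookup A j ⟩ k (≡ₙ-period (apply u lo) k≡) c)
        shifted-letter : ∀ k → lo + k ≡ₙ lo → ⌊ y ⌋ ≡ letter A j (hi + k)
        shifted-letter k k≡ = trans (sym y≡) (⌊⌋-cong (≡ₙ-+ (- 1ℤ) (apply-≡ₙ u (≡ₙ-sym (≡ₙ-period hi k≡)))))
        locate : ∀ {z} → Position lo hi z → z ≡ p → At A (j , ⌊ y ⌋) p q ⊎ At A (j , ⌊ y ⌋) q p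
        locate (first k k≡) e = inj₁ (at
          (subst₂ (Crossing A j) e hi≡ (shifted k k≡))
          (trans (shifted-letter k k≡) (cong (letter A j) hi≡)) s)
          where
          hi≡ : hi + k ≡ q
          hi≡ = trans (sym (swap-first k k≡)) (trans (cong (swap lo hi) e) swap-p≡q)
        locate (second k k≡) e = inj₂ (at
          (subst₂ (Crossing A j) lo≡ e (shifted k (≡ₙ-period lo k≡)))
          (trans (shifted-letter k (≡ₙ-period lo k≡)) (cong (letter A j) e))
          λ z → trans (s z) (cong (apply (π A)) (swap-sym p≢q z)))
          where
          lo≡ : lo + k ≡ q
          lo≡ = trans (sym (swap-second k (crossing-≢ₙ A j c) k≡)) (trans (cong (swap lo hi) e) swap-p≡q)
        locate {z} (other z≢lo z≢hi) e = contradiction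
          (trans (sym e) (trans (sym (swap-other z z≢lo z≢hi)) (trans (cong (swap lo hi) e) swap-p≡q)))
          (p≢q ∘ ≡ₙ-reflexive)

    -- Removing three meetings would leave a factorization of v that is too short.
    two-meetings : Valid A → ∀ {i p q} → Meeting A i p q → Swapped p q v (π A) →
      ∀ {j k} → Meeting A j p q → Meeting A k p q → j ≢ i → k ≢ i → j ≡ k
    two-meetings V {i} {p} {q} mi s {j} {k} mj mk j≢i k≢i = decidable-stable (j Fin.≟ k) λ j≢k →
      let D₁ = delete-meet i (proper V) mi
          D₂ = delete-meet j (Deleted.proper D₁) (Deleted.others D₁ j j≢i mj)
          D₃ = delete-meet k (Deleted.proper D₂) (Deleted.others D₂ k (j≢k ∘ sym) (Deleted.others D₁ k k≢i mk))
          v≈ : v ≈ π (Deleted.B D₃)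
          v≈ z = trans (s z) (trans (sym (Deleted.swapped D₁ z)) (trans
            (cong (apply (π (Deleted.B D₁))) (sym (swap-involutive p q p≢q z)))
            (trans (sym (Deleted.swapped D₂ (swap p q z))) (sym (Deleted.swapped D₃ z)))))
          |B₁| : size (Deleted.B D₁) ≡ ℓv
          |B₁| = ℕ.suc-injective (trans (sym (Deleted.smaller D₁)) (valid-size V))
          |B₁|′ : suc (suc (size (Deleted.B D₃))) ≡ ℓv
          |B₁|′ = trans (sym (trans (Deleted.smaller D₂) (cong suc (Deleted.smaller D₃)))) |B₁|
      in ℕ.<-irrefl refl (ℕ.<-≤-trans (ℕ.m<n⇒m<1+n (ℕ.n<1+n _))
           (subst (ℕ._≤ size (Deleted.B D₃)) (sym |B₁|′) (length-≤-size length-v (Deleted.proper D₃) v≈)))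
      where
      p≢q : p ≢ₙ q
      p≢q = meeting-≢ₙ A i mi

    -- Deleting both meetings multiplies by the same reflection twice and so preserves the product,
    -- which then has a word of only ℓ(v) - 1 letters.
    two-meetings-size : ∀ {k w} → HasLength w k → w ≈ π A → Valid A → ∀ {i j p q} →
      Meeting A i p q → Meeting A j p q → j ≢ i → ¬ k ≡ suc ℓv
    two-meetings-size {k} {w} length-w w≈ V {i} {j} {p} {q} mi mj j≢i k≡ = ℕ.<-irrefl refl
      (ℕ.<-≤-trans (ℕ.m<n⇒m<1+n (ℕ.n<1+n _)) (subst (ℕ._≤ size (Deleted.B D₂)) |A|
        (length-≤-size length-w (Deleted.proper D₂) λ z → trans (w≈ z) (trans
          (cong (apply (π A)) (sym (swap-involutive p q p≢q z)))
          (trans (sym (Deleted.swapped D₁ (swap p q z))) (sym (Deleted.swapped D₂ z)))))))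
      where
      p≢q : p ≢ₙ q
      p≢q = meeting-≢ₙ A i mi
      D₁ : Deleted A i p q
      D₁ = delete-meet i (proper V) mi
      D₂ : Deleted (Deleted.B D₁) j p q
      D₂ = delete-meet j (Deleted.proper D₁) (Deleted.others D₁ j j≢i mj)
      |A| : k ≡ suc (suc (size (Deleted.B D₂)))
      |A| = trans k≡ (trans (sym (valid-size V)) (trans (Deleted.smaller D₁) (cong suc (Deleted.smaller D₂))))

    Only : Fin m → ℤ → ℤ → Set
    Only i p q = ∀ k → Meeting A k p q → k ≡ i

    -- The wires trade places in the second case; this is how r, upper after a replacement, becomes
    -- lower at the next mark.
    data Outcome (μ : Mark) (p q : ℤ) : Set where
      final   : Final A → Only (proj₁ μ) p q → Outcome μ p q
      another : ¬ Final A → ∀ ν → proj₁ ν ≢ proj₁ μ → At A ν q p → Outcome μ p q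

    -- A single meeting makes p, q an inversion of the product, so each of its words is longer than
    -- ℓ(v); the tuple itself supplies one with ℓ(v) + 1 letters.
    only⇒length : Valid A → ∀ {μ p q} → At A μ p q → Only (proj₁ μ) p q → HasLength (π A) (suc ℓv)
    only⇒length V {i , _} x only = size⇒length {π A} (proper V) (λ _ → refl) (valid-size V)
      (inversion-≤ {v} {π A} length-v (inverted (only-start A i (crosses x) only) (only-end A i (crosses x) only)) (swaps x))

    decreasing-elements : ∀ {k} {A : Vec (Subset n) k} → Proper A → VecAll.All CyclicallyDecreasing (Vec.map w⟨_⟩ A)
    decreasing-elements VecAll.[] = VecAll.[]
    decreasing-elements {A = a Vec.∷ _} (a⊂ VecAll.∷ A⊂) = (a , a⊂ , λ _ → refl) VecAll.∷ decreasing-elements A⊂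

    length-elements : ∀ {k} {A : Vec (Subset n) k} → Proper A → Pointwise HasLength (Vec.map w⟨_⟩ A) (Vec.map card A)
    length-elements VecAll.[] = Pointwise.[]
    length-elements (a⊂ VecAll.∷ A⊂) = w-length a⊂ Pointwise.∷ length-elements A⊂

    decomposition : Valid A → ∀ {w} → HasLength w (suc ℓv) → w ≈ π A → IsDecomposition α w (elements A)
    decomposition V {w} length-w w≈ = record
      { length-w   = subst (HasLength w) (sym |α|) length-w
      ; decreasing = decreasing-elements (proper V)
      ; lengths    = subst (Pointwise HasLength (elements A)) (sizes V) (length-elements (proper V))
      ; product    = w≈ }

    outcome : Valid A → ∀ {μ p q} → At A μ p q → Outcome μ p q
    outcome V {i , a} {p} {q} x = decide (Fin.any? λ k → ¬? (k Fin.≟ i) ×-dec meeting? A k p q)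
      where
      decide : Dec (∃[ k ] k ≢ i × Meeting A k p q) → Outcome (i , a) p q
      decide (no none) = final (decomposition V {π A} (only⇒length V x only) λ _ → refl) only
        where
        only : Only i p q
        only k mk = decidable-stable (k Fin.≟ i) λ k≢i → none (k , k≢i , mk)
      decide (yes (k , k≢i , mk)) = another
        (λ F → two-meetings-size {w = π A} (IsDecomposition.length-w F) (λ _ → refl) V (inj₁ (crosses x)) mk k≢i |α|)
        -- At the second meeting `p` is the upper wire, so the letter is taken from it.
        (k , letter A k p) k≢i
        (at (crossing mk) refl λ z → trans (swaps x z) (cong (apply (π A)) (swap-sym (at-≢ₙ x) z)))
        where
        only : ∀ j → Meeting A j p q → j ≡ i ⊎ j ≡ k
        only j mj = either (j Fin.≟ i)
          where
          either : Dec (j ≡ i) → j ≡ i ⊎ j ≡ k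
          either (yes e)  = inj₁ e
          either (no j≢i) = inj₂ (two-meetings V (inj₁ (crosses x)) (swaps x) mj mk j≢i k≢i)
        crossing : Meeting A k p q → Crossing A k q p
        crossing (inj₁ c) = contradiction c (opposite A i k (k≢i ∘ sym) only (crosses x))
        crossing (inj₂ c) = c

    at⇒meeting : ∀ {i b p q} → At A (i , b) p q ⊎ At A (i , b) q p → Meeting A i p q
    at⇒meeting = Sum.map crosses crosses

    -- Both removals belong to meetings of the same two wires; `two-meetings` puts them into one
    -- factor, and two wires cross at a single letter there.
    unique-other : Valid A → ∀ {μ p q} → At A μ p q → ∀ {ν ξ} → proj₁ ν ≢ proj₁ μ → proj₁ ξ ≢ proj₁ μ →
      Removal A ν → Removal A ξ → ν ≡ ξ
    unique-other V {i , _} {p} {q} x {j , b} {k , c} j≢i k≢i rν rξ =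
      same (two-meetings V (inj₁ (crosses x)) (swaps x) (at⇒meeting y) (at⇒meeting z) j≢i k≢i) y z
      where
      y = removal⇒at (proper V) (at-≢ₙ x) (swaps x) rν
      z = removal⇒at (proper V) (at-≢ₙ x) (swaps x) rξ
      same : ∀ {j k} → j ≡ k → At A (j , b) p q ⊎ At A (j , b) q p → At A (k , c) p q ⊎ At A (k , c) q p → (j , b) ≡ (k , c)
      same refl (inj₁ y) z = cong (_ ,_) (at-unique y z)
      same refl (inj₂ y) z = cong (_ ,_) (at-unique y (Sum.swap z))

    unique-removal : Valid A → ∀ {μ p q} → At A μ p q → Only (proj₁ μ) p q → ∀ {ν} → Removal A ν → μ ≡ ν
    unique-removal V {i , a} {p} {q} x only {j , b} rν = same (only j (at⇒meeting y)) y
      where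
      y = removal⇒at (proper V) (at-≢ₙ x) (swaps x) rν
      same : ∀ {j} → j ≡ i → At A (j , b) p q ⊎ At A (j , b) q p → (i , a) ≡ (j , b)
      same refl y = cong (_ ,_) (at-unique x y)

-- The step of the algorithm as an injective partial map.

module Algorithm (n : ℕ) .{{_ : NonTrivial n}} {m : ℕ} (v : AffineSymmetric.S̃ n) (r : ℤ) (α : Vec ℕ m) {ℓv : ℕ}
                 (length-v : AffineSymmetric.HasLength n v ℓv) (|α| : sum α ≡ suc ℓv) where
  open AffineSymmetric n
  open S̃ using (apply; perm)
  open Little v α
  open Residues n
  open Inversions n
  open Bumping n
  open Crossings n
  open Lengths n
  open Marks n v α length-v |α|

  preimage : ∀ u x → ∃[ s ] apply u s ≡ x
  preimage u x = Inverse.from (perm u) x , Inverse.strictlyInverseˡ (perm u) x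

  crossing-update : ∀ {k} (A : Vec (Subset n) k) i {f p q} →
    Inverted w⟨ f (lookup A i) ⟩ (apply (after A i) p) (apply (after A i) q) → Crossing (A [ i ]%= f) i p q
  crossing-update (_ Vec.∷ A) Fin.zero    c = c
  crossing-update (_ Vec.∷ A) (Fin.suc i) c = crossing-update A i c

  letter-update : ∀ {k} (A : Vec (Subset n) k) i {f} p → letter (A [ i ]%= f) i p ≡ letter A i p
  letter-update A i p = cong (λ u → ⌊ apply u p - 1ℤ ⌋) (after-update A i)

  sizes-update : ∀ {k} (A : Vec (Subset n) k) i {f} → card (f (lookup A i)) ≡ card (lookup A i) →
    Vec.map card (A [ i ]%= f) ≡ Vec.map card A
  sizes-update (_ Vec.∷ A) Fin.zero    e = cong (Vec._∷ _) e
  sizes-update (_ Vec.∷ A) (Fin.suc i) e = cong (_ Vec.∷_) (sizes-update A i e)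

  module _ {A : Tuple} {i : Fin m} {p q : ℤ} (V : Valid A) (c : Crossing A i p q) where

    private
      a : Fin n
      a = letter A i q

      A′ : Tuple
      A′ = replace A (i , a)

    crossing-arc : Arc (lookup A i) (apply (after A i) p) (apply (after A i) q)
    crossing-arc = inverted⇒arc (proper-lookup (proper V) i) c

    bump-valid : Valid A′
    bump-valid = valid (proper-update (proper V) i (L-proper crossing-arc))
      (trans (sizes-update A i (L-size crossing-arc)) (sizes V))

    bump-delete : A′ [ i ]%= (_∖ letter A i p) ≡ A [ i ]%= (_∖ a)
    bump-delete = trans (Vec.updateAt-updateAt i A) (Vec.updateAt-cong-local i A (L-∖ crossing-arc))

    -- The old and new tuples agree once their marked letters are removed, so deleting the new
    -- crossing still gives v. The wire p stays, but its partner changes from q to s.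
    bump-at : v ≈ π (A [ i ]%= (_∖ a)) → ∃[ s ] At A′ (i , letter A i p) s p
    bump-at v≈ = from-arc (L-has-arc crossing-arc)
      where
      at-wire : ∀ {s} → Crossing A′ i s p → At A′ (i , letter A i p) s p
      at-wire {s} c′ = at c′ e λ z → trans (v≈ z) (trans (cong (λ B → apply (π B) z) (sym bump-delete))
          (delete-letter-π A′ i (proper bump-valid) c′ e z))
        where
        e : letter A i p ≡ letter A′ i p
        e = sym (letter-update A i {λ Aᵢ → L Aᵢ a} p)
      from-arc : ∃[ x ] Arc (L (lookup A i) a) x (apply (after A i) p) → ∃[ s ] At A′ (i , letter A i p) s p
      from-arc (x , b) = from-wire (preimage (after A i) x)
        where
        from-wire : ∃[ s ] apply (after A i) s ≡ x → ∃[ s ] At A′ (i , letter A i p) s p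
        from-wire (s , refl) = s , at-wire (crossing-update A i {λ Aᵢ → L Aᵢ a} (arc⇒inverted (L-proper crossing-arc) b))

  bump : ∀ {A i a p q} → Valid A → At A (i , a) p q →
    Valid (replace A (i , a)) × ∃[ s ] At (replace A (i , a)) (i , letter A i p) s p
  bump {A} {i} V x = subst (λ a → Valid (replace A (i , a)) × ∃[ s ] At (replace A (i , a)) (i , letter A i _) s _)
    (sym (marked x))
    (bump-valid V (crosses x) ,
     bump-at V (crosses x) (subst (λ a → v ≈ π (A [ i ]%= (_∖ a))) (marked x) (at-delete (proper V) x)))

  -- Factors to the right of i are untouched, so p enters the factor at the same position in both
  -- tuples and `L-injective` applies; the other factors can be read off from the common result.
  bump-injective : ∀ {A A′ i a a′ p q q′} → Valid A → Valid A′ → At A (i , a) p q → At A′ (i , a′) p q′ →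
    replace A (i , a) ≡ replace A′ (i , a′) → A ≡ A′ × a ≡ a′
  bump-injective {A} {A′} {i} {a} {a′} {p} {q} {q′} V V′ x x′ e =
    trans (restore A) (trans (cong₂ (λ B b → B [ i ]%= λ _ → b) e (proj₂ same)) (sym (restore A′))) ,
    trans (marked x) (trans (proj₁ same) (sym (marked x′)))
    where
    after≡ : after A′ i ≡ after A i
    after≡ = trans (sym (after-update A′ i)) (trans (cong (λ B → after B i) (sym e)) (after-update A i))
    lookup≡ : L (lookup A i) (letter A i q) ≡ L (lookup A′ i) (letter A′ i q′)
    lookup≡ = trans (cong (L (lookup A i)) (sym (marked x))) (trans (sym (Vec.lookup∘updateAt i A))
      (trans (cong (λ B → lookup B i) e) (trans (Vec.lookup∘updateAt i A′) (cong (L (lookup A′ i)) (marked x′)))))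
    same : letter A i q ≡ letter A′ i q′ × lookup A i ≡ lookup A′ i
    same = L-injective (crossing-arc V (crosses x))
      (subst (λ u → Arc (lookup A′ i) (apply u p) (apply (after A′ i) q′)) after≡ (crossing-arc V′ (crosses x′)))
      lookup≡
    restore : ∀ (A : Tuple) {f} → A ≡ (A [ i ]%= f) [ i ]%= (λ _ → lookup A i)
    restore A = sym (trans (Vec.updateAt-updateAt i A) (Vec.updateAt-id-local i A refl))

  record Unbumped (B : Tuple) (i : Fin m) (p : ℤ) : Set where
    field
      {A}       : Tuple
      {a}       : Fin n
      {q}       : ℤ
      valid-A   : Valid A
      at-A      : At A (i , a) p q
      replaced≡ : replace A (i , a) ≡ B

  -- As p is the upper wire, the letter just below its position is present, which is what
  -- `L-surjective` asks for.
  unbump : ∀ {B i b s p} → Valid B → At B (i , b) s p → Unbumped B i p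
  unbump {B} {i} {b} {s} {p} V x = from-preimage (L-surjective (proper-lookup (proper V) i) (crossing-∈ B i (proper V) (crosses x)))
    where
    u : S̃
    u = after B i
    from-preimage : Preimage (lookup B i) (apply u p) → Unbumped B i p
    from-preimage P = record { valid-A = V′ ; at-A = at c a≡ swaps′ ; replaced≡ = replaced≡ }
      where
      open Preimage P renaming (A to Aᵢ)
      A′ : Tuple
      A′ = B [ i ]%= λ _ → Aᵢ
      q : ℤ
      q = Inverse.from (perm u) y
      q≡ : apply u q ≡ y
      q≡ = Inverse.strictlyInverseˡ (perm u) y
      a≡ : ⌊ y - 1ℤ ⌋ ≡ letter A′ i q
      a≡ = sym (trans (letter-update B i {λ _ → Aᵢ} q) (cong (λ z → ⌊ z - 1ℤ ⌋) q≡))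
      inv : Inverted w⟨ Aᵢ ⟩ (apply u p) y
      inv = arc⇒inverted {Aᵢ} (Preimage.proper P) {apply u p} {y} arc-A
      c : Crossing A′ i p q
      c = crossing-update B i {λ _ → Aᵢ} {p} {q} (subst (Inverted w⟨ Aᵢ ⟩ (apply u p)) (sym q≡) inv)
      replaced≡ : replace A′ (i , ⌊ y - 1ℤ ⌋) ≡ B
      replaced≡ = trans (Vec.updateAt-updateAt i B) (Vec.updateAt-id-local i B L≡)
      V′ : Valid A′
      V′ = valid (proper-update (proper V) i (Preimage.proper P))
        (trans (sizes-update B i (trans (sym (L-size arc-A)) (cong card L≡))) (sizes V))
      b≡ : letter A′ i p ≡ b
      b≡ = trans (letter-update B i {λ _ → Aᵢ} p) (sym (marked x))
      deleted≡ : B [ i ]%= (_∖ b) ≡ A′ [ i ]%= (_∖ ⌊ y - 1ℤ ⌋)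
      deleted≡ = trans (cong₂ (λ B b → B [ i ]%= (_∖ b))
          (trans (sym replaced≡) (cong (λ a → replace A′ (i , a)) a≡)) (sym b≡))
        (trans (bump-delete V′ c) (cong (λ a → A′ [ i ]%= (_∖ a)) (sym a≡)))
      swaps′ : Swapped p q v (π A′)
      swaps′ z = trans (at-delete (proper V) x z) (trans (cong (λ B → apply (π B) z) deleted≡)
        (delete-letter-π A′ i (proper V′) c a≡ z))

  State : Set
  State = Tuple × Mark

  replaced : State → Tuple
  replaced (A , μ) = replace A μ

  -- A state is low before its mark is replaced and high right after. Input tuples give low states,
  -- output tuples high ones.
  Low High : State → Set
  Low  (A , μ) = Valid A × ∃[ s ] At A μ r s
  High (A , μ) = Valid A × ∃[ s ] At A μ s r

  -- Steps join low states. The field `unfinal` keeps them from entering an input tuple and from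
  -- producing an output tuple, which therefore bound the orbits.
  record Step (σ τ : State) : Set where
    field
      low-σ    : Low σ
      low-τ    : Low τ
      tuple≡   : proj₁ τ ≡ replaced σ
      unfinal  : ¬ Final (proj₁ τ)
      distinct : proj₁ (proj₂ τ) ≢ proj₁ (proj₂ σ)

  open Step

  mark* : State → Mark
  mark* (A , i , _) = i , letter A i r

  bump-low : ∀ {σ} → Low σ → High (replaced σ , mark* σ)
  bump-low (V , _ , x) = bump V x

  step-high : ∀ {σ τ} → Step σ τ → High (proj₁ τ , mark* σ)
  step-high {σ} s = subst (λ B → High (B , mark* σ)) (sym (tuple≡ s)) (bump-low (low-σ s))

  -- The product sends either partner of r to `apply v r`.
  wire-unique : ∀ {A μ ν s s′} → At A μ r s → At A ν s′ r → s ≡ s′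
  wire-unique {A} {s = s} {s′} x y = apply-injective (π A) (trans (cong (apply (π A)) (sym (swap-p {r} {s})))
    (trans (sym (swaps x r)) (trans (swaps y r) (cong (apply (π A)) (swap-q {s′} {r} (at-≢ₙ y))))))

  step-deterministic : ∀ {σ τ υ} → Step σ τ → Step σ υ → τ ≡ υ
  step-deterministic {σ} {B , ν} {C , ξ} s t = same (trans (tuple≡ s) (sym (tuple≡ t))) (low-τ t)
    where
    same : ∀ {C} → B ≡ C → Low (C , ξ) → (B , ν) ≡ (C , ξ)
    same refl (V , _ , y) = cong (B ,_) (unique-other V (proj₂ (proj₂ (step-high s))) (distinct s) (distinct t)
      (at⇒removal (proper V) (proj₂ (proj₂ (low-τ s)))) (at⇒removal (proper V) y))

  -- Both previous marks are meetings, other than the current one, of r with the same partner. By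
  -- `two-meetings` they lie in one factor, and there the replacement is injective.
  step-codeterministic : ∀ {σ τ υ} → Step σ υ → Step τ υ → σ ≡ τ
  step-codeterministic {A , i , a} {A′ , i′ , a′} {B , ν} s t = same
      (two-meetings V (inj₁ (crosses z)) (swaps z) (meets (step-high s)) (meets (step-high t))
        (distinct s ∘ sym) (distinct t ∘ sym))
      (low-σ t) (trans (sym (tuple≡ s)) (tuple≡ t))
    where
    V : Valid B
    V = proj₁ (low-τ s)
    z : At B ν r (proj₁ (proj₂ (low-τ s)))
    z = proj₂ (proj₂ (low-τ s))
    meets : ∀ {μ} → High (B , μ) → Meeting B (proj₁ μ) r (proj₁ (proj₂ (low-τ s)))
    meets {μ} (_ , s′ , x) = inj₂ (subst (λ s → Crossing B (proj₁ μ) s r) (sym (wire-unique z x)) (crosses x))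
    same : ∀ {i′} → i ≡ i′ → Low (A′ , i′ , a′) → replace A (i , a) ≡ replace A′ (i′ , a′) → (A , i , a) ≡ (A′ , i′ , a′)
    same refl (V′ , _ , y) e = let A≡ , a≡ = bump-injective (proj₁ (low-σ s)) V′ (proj₂ (proj₂ (low-σ s))) y e in
      cong₂ (λ A a → A , i , a) A≡ a≡

  advance : ∀ {σ} → Low σ → (Low σ × Final (replaced σ)) ⊎ ∃[ τ ] Step σ τ
  advance {σ} low = decide (outcome (proj₁ high) (proj₂ (proj₂ high)))
    where
    high : High (replaced σ , mark* σ)
    high = bump-low low
    decide : Outcome {replaced σ} (mark* σ) (proj₁ (proj₂ high)) r → (Low σ × Final (replaced σ)) ⊎ ∃[ τ ] Step σ τ
    decide (final F _) = inj₁ (low , F)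
    decide (another ¬F ν ν≢ x) = inj₂ ((replaced σ , ν) , record
      { low-σ = low ; low-τ = proj₁ high , _ , x ; tuple≡ = refl ; unfinal = ¬F ; distinct = ν≢ })

  -- A second meeting has r as its upper wire, so the replacement can be undone there.
  retreat : ∀ {σ} → Low σ → (Low σ × Final (proj₁ σ)) ⊎ ∃[ τ ] Step τ σ
  retreat {A , μ} low@(V , s , x) = decide (outcome V x)
    where
    decide : Outcome {A} μ r s → (Low (A , μ) × Final A) ⊎ ∃[ τ ] Step τ (A , μ)
    decide (final F _) = inj₁ (low , F)
    decide (another ¬F (j , b) j≢ y) = inj₂ (_ , record
      { low-σ = Unbumped.valid-A U , _ , Unbumped.at-A U
      ; low-τ = low
      ; tuple≡ = sym (Unbumped.replaced≡ U)
      ; unfinal = ¬F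
      ; distinct = j≢ ∘ sym })
      where
      U : Unbumped A j r
      U = unbump V y

  code : State → Fin _
  code (A , i , a) = Fin.combine (code-vec code-subset A) (Fin.combine i a)

  code-injective : ∀ {σ τ} → code σ ≡ code τ → σ ≡ τ
  code-injective {A , i , a} {B , j , b} e =
    let e₁ , e₂ = Fin.combine-injective (code-vec code-subset A) (Fin.combine i a) _ _ e
        e₃ , e₄ = Fin.combine-injective i a j b e₂
    in cong₂ _,_ (code-vec-injective code-subset code-subset-injective e₁) (cong₂ _,_ e₃ e₄)

  final-first : ∀ {σ} → Final (proj₁ σ) → ∀ {τ} → ¬ Step τ σ
  final-first F s = unfinal s F

  final-last : ∀ {σ} → Final (replaced σ) → ∀ {τ} → ¬ Step σ τ
  final-last F s = unfinal s (subst Final (sym (tuple≡ s)) F)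

  forward : ∀ {σ} → Low σ → Final (proj₁ σ) → ∃[ τ ] Star Step σ τ × Low τ × Final (replaced τ)
  forward low F = reaches-goal code code-injective step-codeterministic
    (advance ∘ low-τ) (final-first F) (advance low)

  -- The search of `forward` along reversed steps: determinism takes the place of injectivity.
  backward : ∀ {τ} → Low τ → Final (replaced τ) → ∃[ σ ] Star (flip Step) τ σ × Low σ × Final (proj₁ σ)
  backward low F = reaches-goal {_⇒_ = flip Step} code code-injective step-deterministic
    (retreat ∘ low-σ) (final-last F) (retreat low)

  -- That the next mark is unique at each iteration comes from `unique-other`, applied to the
  -- crossing that the replacement has just created.
  run : ∀ {A μ τ} → Star Step (A , μ) τ → Final (replaced τ) → Run A μ (replaced τ)
  run ε F = stop F
  run {A} {μ} (_◅_ {j = B , ν} s ss) F = continue (tuple≡ s) (unfinal s) (low-τ s) (step-high s) (run ss F)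
    where
    continue : ∀ {B C} → B ≡ replace A μ → ¬ Final B → Low (B , ν) → High (B , mark* (A , μ)) → Run B ν C → Run A μ C
    continue refl ¬F (V , _ , y) (_ , _ , x) = loop ¬F
      (ν , (distinct s , at⇒removal (proper V) y) , λ (ξ≢ , removal) → unique-other V x (distinct s) ξ≢ (at⇒removal (proper V) y) removal)

-- The bijection between the two sets of decompositions.

module Correspondence (n : ℕ) .{{_ : NonTrivial n}} {m : ℕ} (v : AffineSymmetric.S̃ n) (r : ℤ) (α : Vec ℕ m) {ℓv : ℕ}
                      (length-v : AffineSymmetric.HasLength n v ℓv) (|α| : sum α ≡ suc ℓv) where
  open AffineSymmetric n
  open S̃ using (apply)
  open Little v α
  open Inversions n
  open Crossings n
  open Lengths n
  open Marks n v α length-v |α|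
  open Algorithm n v r α length-v |α|

  _≋_ : ∀ {k} → Vec S̃ k → Vec S̃ k → Set
  _≋_ = Pointwise _≈_

  ≋-sym : ∀ {k} {us ws : Vec S̃ k} → us ≋ ws → ws ≋ us
  ≋-sym Pointwise.[]        = Pointwise.[]
  ≋-sym (e Pointwise.∷ es) = (λ z → sym (e z)) Pointwise.∷ ≋-sym es

  ≋-trans : ∀ {k} {us ws xs : Vec S̃ k} → us ≋ ws → ws ≋ xs → us ≋ xs
  ≋-trans Pointwise.[]        Pointwise.[]        = Pointwise.[]
  ≋-trans (e Pointwise.∷ es) (f Pointwise.∷ fs) = (λ z → trans (e z) (f z)) Pointwise.∷ ≋-trans es fs

  ≋-reflexive : ∀ {A B : Tuple} → A ≡ B → elements A ≋ elements B
  ≋-reflexive {A} refl = go A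
    where
    go : ∀ {k} (A : Vec (Subset n) k) → Vec.map w⟨_⟩ A ≋ Vec.map w⟨_⟩ A
    go Vec.[]      = Pointwise.[]
    go (_ Vec.∷ A) = (λ _ → refl) Pointwise.∷ go A

  ∏-cong : ∀ {k} {us ws : Vec S̃ k} → us ≋ ws → ∏ us ≈ ∏ ws
  ∏-cong Pointwise.[] z = refl
  ∏-cong (Pointwise._∷_ {x = u} e es) z = trans (cong (apply u) (∏-cong es z)) (e _)

  elements-injective : ∀ {k} {A B : Vec (Subset n) k} → Proper A → Proper B →
    Vec.map w⟨_⟩ A ≋ Vec.map w⟨_⟩ B → A ≡ B
  elements-injective VecAll.[] VecAll.[] _ = refl
  elements-injective (a⊂ VecAll.∷ A⊂) (b⊂ VecAll.∷ B⊂) (e Pointwise.∷ es) =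
    cong₂ Vec._∷_ (w-injective a⊂ b⊂ e) (elements-injective A⊂ B⊂ es)

  represent : ∀ {k} {ys : Vec S̃ k} → VecAll.All CyclicallyDecreasing ys →
    ∃[ A ] Proper A × ys ≋ Vec.map w⟨_⟩ A
  represent VecAll.[] = Vec.[] , VecAll.[] , Pointwise.[]
  represent ((a , a⊂ , e) VecAll.∷ ds) = let A , A⊂ , es = represent ds in
    a Vec.∷ A , a⊂ VecAll.∷ A⊂ , e Pointwise.∷ es

  represented-sizes : ∀ {k} {ys : Vec S̃ k} {A β} → Proper A → ys ≋ Vec.map w⟨_⟩ A → Pointwise HasLength ys β →
    Vec.map card A ≡ β
  represented-sizes VecAll.[] Pointwise.[] Pointwise.[] = refl
  represented-sizes (a⊂ VecAll.∷ A⊂) (Pointwise._∷_ {x = y} {y = u} e es) (l Pointwise.∷ ls) =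
    cong₂ Vec._∷_ (length-unique {u} {y} (λ z → sym (e z)) (w-length a⊂) l) (represented-sizes A⊂ es ls)

  -- If v inverted p < q, its words would be longer than the product; so the product inverts them
  -- and they meet, only once because of its length, and with p below since p < q. The roles of r
  -- are p for `Ψ⁺` and q for `Ψ⁻`.
  initial : ∀ {A p q} (p≢q : p ≢ₙ q) → p < q → Valid A → HasLength (π A) (suc ℓv) → Swapped p q (π A) v →
    ∃[ μ ] At A μ p q × Only {A} (proj₁ μ) p q
  initial {A} {p} {q} p≢q p<q V length-A s = from-meeting (inversion⇒meeting A (inverted p<q
      (subst₂ _<_ (sym (trans (s q) (cong (apply v) (swap-q {p} {q} p≢q))))
                  (sym (trans (s p) (cong (apply v) (swap-p {p} {q})))) vp<vq)))
    where
    vp<vq : apply v p < apply v q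
    vp<vq = apart-order {v} (λ c → too-short (HasLength.attained length-v) c) p<q
      where
      too-short : ∃[ W ] List.length W ≡ ℓv × v ≈ ⟦ W ⟧ → ¬ Inverted v p q
      too-short (W , |W| , v≈W) c = ℕ.<-asym (ℕ.n<1+n ℓv)
        (subst (suc ℓv ℕ.<_) |W| (inversion-≤ {π A} {v} length-A c s W v≈W))
    s′ : Swapped p q v (π A)
    s′ z = trans (cong (apply v) (sym (swap-involutive p q p≢q z))) (sym (s (swap p q z)))
    from-meeting : ∃[ i ] Meeting A i p q → ∃[ μ ] At A μ p q × Only {A} (proj₁ μ) p q
    from-meeting (i , mi) = (i , letter A i q) , at (crossing mi) refl s′ , only
      where
      only : Only {A} i p q
      only j mj = decidable-stable (j Fin.≟ i) λ j≢i →
        two-meetings-size {w = π A} length-A (λ _ → refl) V mi mj j≢i refl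
      crossing : Meeting A i p q → Crossing A i p q
      crossing (inj₁ c) = c
      crossing (inj₂ c) = contradiction (only-start A i c λ k mk → only k (Sum.swap mk)) (ℤ.<-asym p<q)

  final⇒length : ∀ {A} → Final A → HasLength (π A) (suc ℓv)
  final⇒length {A} F = subst (HasLength (π A)) |α| (IsDecomposition.length-w F)

  final⇒only : ∀ {A μ p q} → Final A → Valid A → At A μ p q → Only {A} (proj₁ μ) p q
  final⇒only {A} F V x j mj = decidable-stable (j Fin.≟ _) λ j≢i →
    two-meetings-size {w = π A} (final⇒length F) (λ _ → refl) V (inj₁ (crosses x)) mj j≢i refl

  mark-unique : ∀ {A μ ν p q p′ q′} → Final A → Valid A → At A μ p q → At A ν p′ q′ → μ ≡ ν
  mark-unique F V x y = unique-removal V x (final⇒only F V x) (at⇒removal (proper V) y)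

  cover : ∀ {A μ p q} → Final A → Valid A → At A μ p q → v ⋖ π A
  cover {A} F V x = record
    { reflection = _ , _ , at-≢ₙ x , swapped-back {A} (at-≢ₙ x) (swaps x)
    ; length+1   = ℓv , length-v , final⇒length F }

  at-< : ∀ {A μ p q} → Final A → Valid A → At A μ p q → p < q
  at-< {A} {i , _} F V x = only-start A i (crosses x) (final⇒only F V x)

  Source Target : Setoid 0ℓ 0ℓ
  Source = Decompositions α (Ψ⁺ r v)
  Target = Decompositions α (Ψ⁻ r v)

  -- In a final tuple the marked wires meet only once, so they enter in the order in which they
  -- cross; this gives s > r here and s < r for `target`.
  source : ∀ {σ} → Low σ → Final (proj₁ σ) → Setoid.Carrier Source
  source {A , μ} (V , s , x) F = elements A , π A ,
    (cover F V x , s , at-≢ₙ x , at-< F V x , swapped-back {A} (at-≢ₙ x) (swaps x)) , F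

  target : ∀ {τ} → High τ → Final (proj₁ τ) → Setoid.Carrier Target
  target {A , μ} (V , s , x) F = elements A , π A ,
    (cover F V x , s , at-≢ₙ x , at-< F V x , swapped-back {A} (at-≢ₙ x) (swaps x)) , F

  module _ {w : S̃} {ys : Vec S̃ m} (dec : IsDecomposition α w ys) where
    open IsDecomposition dec

    represented-valid : ∀ {A} → Proper A → ys ≋ elements A → Valid A
    represented-valid A⊂ e = valid A⊂ (represented-sizes A⊂ e lengths)

    represented-product : ∀ {A} → ys ≋ elements A → w ≈ π A
    represented-product e z = trans (product z) (∏-cong e z)

    represented-length : ∀ {A} → ys ≋ elements A → HasLength (π A) (suc ℓv)
    represented-length {A} e = let W , |W| , w≈W = HasLength.attained length-w in record
      { attained = W , trans |W| |α| , λ z → trans (sym (represented-product e z)) (w≈W z)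
      ; minimal  = λ W A≈W → subst (ℕ._≤ List.length W) |α|
          (HasLength.minimal length-w W λ z → trans (represented-product e z) (A≈W z)) }

    started : ∀ {A p q} (p≢q : p ≢ₙ q) → p < q → Proper A → ys ≋ elements A → w ≈ v · t p q p≢q →
      Valid A × (∃[ μ ] At A μ p q) × Final A
    started {A} {p} {q} p≢q p<q A⊂ e w≈ = V , (proj₁ start , proj₁ (proj₂ start)) ,
        decomposition V {π A} (represented-length e) λ _ → refl
      where
      V : Valid A
      V = represented-valid A⊂ e
      start : ∃[ μ ] At A μ p q × Only {A} (proj₁ μ) p q
      start = initial p≢q p<q V (represented-length e) λ z → trans (sym (represented-product e z)) (w≈ z)

  record Started (P : State → Set) (ys : Vec S̃ m) : Set where
    constructor started-at
    field
      {state}  : State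
      valid-st : P state
      final-st : Final (proj₁ state)
      elems    : ys ≋ elements (proj₁ state)

  open Started

  start⁺ : (D : Setoid.Carrier Source) → Started Low (proj₁ D)
  start⁺ (ys , w , (_ , s , r≢s , s>r , w≈) , dec) =
    let A , A⊂ , e = represent (IsDecomposition.decreasing dec)
        V , (μ , x) , F = started dec r≢s s>r A⊂ e w≈
    in started-at {state = A , μ} (V , s , x) F e

  start⁻ : (E : Setoid.Carrier Target) → Started High (proj₁ E)
  start⁻ (ys , w , (_ , s , s≢r , s<r , w≈) , dec) =
    let A , A⊂ , e = represent (IsDecomposition.decreasing dec)
        V , (μ , x) , F = started dec s≢r s<r A⊂ e w≈
    in started-at {state = A , μ} (V , s , x) F e

  low-unique : ∀ {σ τ} → Low σ → Final (proj₁ σ) → Low τ → proj₁ σ ≡ proj₁ τ → σ ≡ τ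
  low-unique (V , _ , x) F (_ , _ , y) refl = cong (_ ,_) (mark-unique F V x y)

  record Path (σ : State) : Set where
    constructor path
    field
      {end}     : State
      steps     : Star Step σ end
      low-end   : Low end
      final-end : Final (replaced end)

  open Path

  run-path : ∀ {ys} (S : Started Low ys) → Path (state S)
  run-path S = let _ , steps , low , F = forward (valid-st S) (final-st S) in path steps low F

  path-unique : ∀ {σ} (P Q : Path σ) → end P ≡ end Q
  path-unique P Q = star-deterministic step-deterministic (steps P) (steps Q) (final-last (final-end P)) (final-last (final-end Q))

  started-unique : ∀ {ys zs} (S : Started Low ys) (T : Started Low zs) → ys ≋ zs → state S ≡ state T
  started-unique S T e = low-unique (valid-st S) (final-st S) (valid-st T)
    (elements-injective (proper (proj₁ (valid-st S))) (proper (proj₁ (valid-st T)))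
      (≋-trans (≋-sym (elems S)) (≋-trans e (elems T))))

  end-unique : ∀ {σ τ} → σ ≡ τ → (P : Path σ) (Q : Path τ) → end P ≡ end Q
  end-unique refl = path-unique

  -- An output tuple has a single letter whose removal gives v, so both replacements took place in
  -- the same factor.
  replaced-injective : ∀ {σ τ} → Low σ → Low τ → Final (replaced σ) → replaced σ ≡ replaced τ → σ ≡ τ
  replaced-injective {A , i , a} {A′ , i′ , a′} l@(V , _ , x) l′@(V′ , _ , x′) F e =
    same (cong proj₁ (marks (bump-low l) (subst (λ B → High (B , i′ , letter A′ i′ r)) (sym e) (bump-low l′)))) x′ e
    where
    marks : High (replace A (i , a) , i , letter A i r) → High (replace A (i , a) , i′ , letter A′ i′ r) →
            (i , letter A i r) ≡ (i′ , letter A′ i′ r)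
    marks (W , _ , y) (_ , _ , z) = mark-unique F W y z
    same : ∀ {i′ s′} → i ≡ i′ → At A′ (i′ , a′) r s′ → replace A (i , a) ≡ replace A′ (i′ , a′) → (A , i , a) ≡ (A′ , i′ , a′)
    same refl x′ e = let A≡ , a≡ = bump-injective V V′ x x′ e in cong₂ (λ A a → A , i , a) A≡ a≡

  start-unique : ∀ {σ σ′ τ τ′} → Star Step σ τ → Star Step σ′ τ′ → τ ≡ τ′ →
    Final (proj₁ σ) → Final (proj₁ σ′) → σ ≡ σ′
  start-unique ss ss′ refl F F′ = star-deterministic {_⇒_ = flip Step} step-codeterministic
    (Star.reverse (λ s → s) ss) (Star.reverse (λ s → s) ss′) (final-first F) (final-first F′)

  to-target : Setoid.Carrier Source → Setoid.Carrier Target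
  to-target D = let P = run-path (start⁺ D) in target (bump-low (low-end P)) (final-end P)

  path-of : (D : Setoid.Carrier Source) → Path (state (start⁺ D))
  path-of D = run-path (start⁺ D)

  to-cong : ∀ {D D′} → proj₁ D ≋ proj₁ D′ → proj₁ (to-target D) ≋ proj₁ (to-target D′)
  to-cong {D} {D′} e = ≋-reflexive (cong replaced
    (end-unique (started-unique (start⁺ D) (start⁺ D′) e) (path-of D) (path-of D′)))

  to-injective : ∀ {D D′} → proj₁ (to-target D) ≋ proj₁ (to-target D′) → proj₁ D ≋ proj₁ D′
  to-injective {D} {D′} e = ≋-trans (elems S) (≋-trans (≋-reflexive (cong proj₁ states)) (≋-sym (elems S′)))
    where
    S = start⁺ D
    S′ = start⁺ D′
    P = path-of D
    P′ = path-of D′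
    replaced≡ : replaced (end P) ≡ replaced (end P′)
    replaced≡ = elements-injective (proper (proj₁ (bump-low (low-end P)))) (proper (proj₁ (bump-low (low-end P′)))) e
    states : state S ≡ state S′
    states = start-unique (steps P) (steps P′) (replaced-injective (low-end P) (low-end P′) (final-end P) replaced≡)
      (final-st S) (final-st S′)

  -- Undoing the last replacement gives a low state, from which steps are retraced to an input
  -- tuple.
  to-surjective : ∀ E → ∃[ D ] (∀ {D′} → proj₁ D′ ≋ proj₁ D → proj₁ (to-target D′) ≋ proj₁ E)
  to-surjective E = from-state (start⁻ E)
    where
    from-state : Started High (proj₁ E) → ∃[ D ] (∀ {D′} → proj₁ D′ ≋ proj₁ D → proj₁ (to-target D′) ≋ proj₁ E)
    from-state (started-at {B , i , b} (V , _ , x) F e) = D , λ {D′} e′ → ≋-trans (to-cong {D′} {D} e′) to-E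
      where
      U : Unbumped B i r
      U = unbump V x
      open Unbumped U
      last : State
      last = A , i , a
      last-low : Low last
      last-low = valid-A , _ , at-A
      last-final : Final (replaced last)
      last-final = subst Final (sym replaced≡) F
      back : ∃[ σ ] Star (flip Step) last σ × Low σ × Final (proj₁ σ)
      back = backward last-low last-final
      first-low : Low (proj₁ back)
      first-low = proj₁ (proj₂ (proj₂ back))
      first-final : Final (proj₁ (proj₁ back))
      first-final = proj₂ (proj₂ (proj₂ back))
      D : Setoid.Carrier Source
      D = source first-low first-final
      S : Started Low (proj₁ D)
      S = started-at first-low first-final (≋-reflexive refl)
      P : Path (state S)
      P = path (Star.reverse (λ s → s) (proj₁ (proj₂ back))) last-low last-final
      -- `to-target` chooses its own start and path for D; uniqueness of both identifies them with
      -- the retraced path.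
      to-E : proj₁ (to-target D) ≋ proj₁ E
      to-E = ≋-trans (≋-reflexive (trans
        (cong replaced (end-unique (started-unique (start⁺ D) S (≋-reflexive refl)) (path-of D) P)) replaced≡)) (≋-sym e)

  bijection : Bijection Source Target
  bijection = record
    { to        = to-target
    ; cong      = λ {D} {D′} → to-cong {D} {D′}
    ; bijective = (λ {D} {D′} → to-injective {D} {D′}) , to-surjective }

  -- By `w-injective`, any `A` that represents the tuple is the one chosen for D, so the path behind
  -- `to-target` serves all choices.
  outputs : ∀ D → Outputs (proj₁ D) (proj₁ (to-target D))
  outputs D A A⊂ e = subst Result (sym A≡) result
    where
    S = start⁺ D
    P = path-of D
    V : Valid (proj₁ (state S))
    V = proj₁ (valid-st S)
    x : At (proj₁ (state S)) (proj₂ (state S)) r (proj₁ (proj₂ (valid-st S)))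
    x = proj₂ (proj₂ (valid-st S))
    A≡ : A ≡ proj₁ (state S)
    A≡ = elements-injective A⊂ (proper V) (≋-trans (≋-sym e) (elems S))
    Result : Tuple → Set
    Result A = Σ[ p! ∈ ∃! _≡_ (Removal A) ] ∃[ B ] Run A (proj₁ p!) B × proj₁ (to-target D) ≋ elements B
    result : Result (proj₁ (state S))
    result = (proj₂ (state S) , at⇒removal (proper V) x , unique-removal V x (final⇒only (final-st S) V x)) ,
      replaced (end P) , run (steps P) (final-end P) , ≋-reflexive refl

theorem14 : (n : ℕ) .{{_ : NonTrivial n}} → let open AffineSymmetric n in
    (v : S̃) (r : ℤ) {m ℓv : ℕ} (α : Vec ℕ m) → HasLength v ℓv → sum α ≡ suc ℓv →
    Σ[ φ ∈ Bijection (Decompositions α (Ψ⁺ r v)) (Decompositions α (Ψ⁻ r v)) ]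
    (∀ D → Little.Outputs v α (proj₁ D) (proj₁ (Bijection.to φ D)))
theorem14 n v r α length-v |α| = bijection , outputs
  where open Correspondence n v r α length-v |α|
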